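{- Let $H=(V,E)$ be a finite ordered $3$-uniform hypergraph with $E\neq\varnothing$ that admits a proper two-colouring, and let $\mathcal C(H)$ be the set of its proper two-colourings modulo global complementation. Then: (i) $\mathrm{NCF}(e_H)=1$ if and only if some probability distribution on proper two-colourings of $H$ makes every minority position on every hyperedge have probability $\frac13$; (ii) $\mathrm{NCF}(e_H)=\frac13$ if and only if some event $(e,j)$, with $e\in E$ and $j\in\{1,2,3\}$, is frozen, meaning $m_e(S)=j$ for every $S\in\mathcal C(H)$.
   Context: An ordered $3$-uniform hypergraph has hyperedges that are ordered triples $e=(v_1,v_2,v_3)$ of distinct vertices. A proper two-colouring is a map $V\to\{0,1\}$ nonconstant on every hyperedge; it is identified with its global complement, and $\mathcal C(H)$ is the set of complement classes. For $e=(v_1,v_2,v_3)\in E$ and $S\in\mathcal C(H)$, $m_e(S)\in\{1,2,3\}$ is the minority position: the index $j$ such that the colour of $v_j$ differs from the common colour of the other two vertices of $e$. $\mathrm{NAE}_3=\{0,1\}^3\setminus\{000,111\}$. The uniform $\mathrm{NAE}_3$ empirical model $e_H$: observables (outcomes in $\{0,1\}$) are one central observable for each non-isolated vertex, and for each $e=(v_1,v_2,v_3)\in E$ and $j$ a fresh observable $v_j^e$. Contexts and tables: for each $e$, the context $(v_1^e,v_2^e,v_3^e)$ with the uniform distribution on $\mathrm{NAE}_3$ (mass $1/6$ on each of the six tuples, $0$ otherwise); for each $e,j$, the context $(v_j,v_j^e)$ with mass $1/2$ on $(0,0)$ and on $(1,1)$ and $0$ otherwise. For a finite empirical model $e$ with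 tables $e_C$, $\mathrm{NCF}(e)=\max\{\sum_g b_g:\ \sum_{g:\,g|_C=u}b_g\le e_C(u)\text{ for all contexts }C\text{ and local outcomes }u,\ b_g\ge0\}$, where $g$ ranges over all global assignments of outcomes to observables. -}

module Defs where

open import Algebra.Bundles using (CommutativeRing)
import Algebra.Properties.Ring as RingProperties
import Algebra.Properties.Semiring.Mult as SemiringMult
open import Data.Bool.Base using (Bool; true; false; not; if_then_else_)
import Data.Bool.Properties as Bool
open import Data.Fin.Base using (Fin)
open import Data.Fin.Patterns using (0F; 1F; 2F)
open import Data.Fin.Properties using (any?; all?; +↔⊎; *↔×)
import Data.Fin.Properties as Fin
open import Data.List.Base using (List; filter; allFin; length)
open import Data.List.Membership.Propositional.Properties using (∈-filter⁺; ∈-allFin)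
open import Data.List.Relation.Unary.Any using (index)
open import Data.Nat.Base as ℕ using (ℕ; zero; suc; NonZero)
open import Data.Product.Base using (Σ; ∃; ∃₂; ∃-syntax; _×_; _,_; proj₁; proj₂)
open import Data.Sum.Base using (_⊎_; inj₁; inj₂)
open import Data.Sum.Function.Propositional using (_⊎-↔_)
open import Data.Vec.Base using (Vec; []; _∷_; lookup; map)
import Data.Vec.Properties as Vec
open import Data.Vec.Relation.Unary.Unique.Propositional using (Unique)
open import Function.Base using (_∘_)
open import Function.Bundles using (_↔_; Inverse; Func; _⟨$⟩_)
open import Function.Definitions using (Injective)
open import Function.Properties.Inverse using (↔-refl; ↔-sym; ↔-trans)
open import Level using (Level; _⊔_)
open import Relation.Binary.Bundles using (Setoid)
open import Relation.Binary.PropositionalEquality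
  using (_≡_; _≢_; refl; sym; trans; cong; subst; setoid)
open import Relation.Binary.Structures using (IsTotalOrder)
open import Relation.Nullary using (¬_; Dec; yes; no; does; from-yes)
open import Relation.Nullary.Decidable using (¬?; _×-dec_)
open import Relation.Nullary.Negation using (contradiction)
open import Relation.Unary using (Pred; Decidable)

------------------------------------------------------------------------
-- Scalars

-- The library has no real numbers, so masses and probabilities live in an
-- arbitrary (classical, linearly) ordered field; ℝ and ℚ are the instances
-- of interest. The value of 0# ⁻¹ is unspecified.
record OrderedField (c ℓ₁ ℓ₂ : Level) : Set (Level.suc (c ⊔ ℓ₁ ⊔ ℓ₂)) where
  infix  4 _≤_
  infix  8 _⁻¹
  field
    commutativeRing : CommutativeRing c ℓ₁
  open CommutativeRing commutativeRing public
  field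
    _⁻¹          : Carrier → Carrier
    _≤_          : Carrier → Carrier → Set ℓ₂
    0≉1          : ¬ (0# ≈ 1#)
    ⁻¹-cong      : ∀ {x y} → x ≈ y → x ⁻¹ ≈ y ⁻¹
    ⁻¹-inverseʳ  : ∀ x → ¬ (x ≈ 0#) → x * x ⁻¹ ≈ 1#
    isTotalOrder : IsTotalOrder _≈_ _≤_
    +-monoˡ-≤    : ∀ {x y} z → x ≤ y → x + z ≤ y + z
    *-nonNeg     : ∀ {x y} → 0# ≤ x → 0# ≤ y → 0# ≤ x * y

module Scalars {c ℓ₁ ℓ₂} (K : OrderedField c ℓ₁ ℓ₂) where
  open OrderedField K hiding (setoid)
    renaming (refl to ≈-refl; sym to ≈-sym; trans to ≈-trans)
  open IsTotalOrder isTotalOrder using (total; antisym; ≤-respˡ-≈; ≤-respʳ-≈)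
    renaming (refl to ≤-refl; trans to ≤-trans)
  open SemiringMult semiring using (×-congʳ; ×-assoc-*)
  open SemiringMult semiring public using () renaming (_×_ to _·_)
  open RingProperties ring using (-‿distribˡ-*; -‿distribʳ-*; -‿involutive)

  1/ : ℕ → Carrier
  1/ n = (n · 1#) ⁻¹

  [_]·_ : ∀ {p} {P : Set p} → Dec P → Carrier → Carrier
  [ P? ]· x = if does P? then x else 0#

  ∑ : ∀ {n} → (Vec Bool n → Carrier) → Carrier
  ∑ {zero}  f = f []
  ∑ {suc n} f = ∑ (f ∘ (false ∷_)) + ∑ (f ∘ (true ∷_))

  private
    neg-nonNeg : ∀ {x} → x ≤ 0# → 0# ≤ - x
    neg-nonNeg {x} x≤0 = ≤-respˡ-≈ (-‿inverseʳ x) (≤-respʳ-≈ (+-identityˡ (- x)) (+-monoˡ-≤ (- x) x≤0))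

  0≤1 : 0# ≤ 1#
  0≤1 with total 0# 1#
  ... | inj₁ 0≤1 = 0≤1
  ... | inj₂ 1≤0 = ≤-respʳ-≈ [-1]²≈1 (*-nonNeg 0≤-1 0≤-1)
    where
    0≤-1 = neg-nonNeg 1≤0
    [-1]²≈1 : - 1# * - 1# ≈ 1#
    [-1]²≈1 = ≈-trans (≈-sym (-‿distribˡ-* 1# (- 1#)))
      (≈-trans (-‿cong (*-identityˡ (- 1#))) (-‿involutive 1#))

  x≤x+1 : ∀ x → x ≤ x + 1#
  x≤x+1 x = ≤-respˡ-≈ (+-identityˡ x) (≤-respʳ-≈ (+-comm 1# x) (+-monoˡ-≤ x 0≤1))

  0≤n·1 : ∀ n → 0# ≤ n · 1#
  0≤n·1 zero    = ≤-refl
  0≤n·1 (suc n) = ≤-trans (0≤n·1 n) (≤-respʳ-≈ (+-comm (n · 1#) 1#) (x≤x+1 (n · 1#)))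

  1+n·1≉0 : ∀ n → ¬ (suc n · 1# ≈ 0#)
  1+n·1≉0 n eq = 0≉1 (antisym 0≤1 (≤-respʳ-≈ eq 1≤1+n))
    where
    1≤1+n : 1# ≤ suc n · 1#
    1≤1+n = ≤-respˡ-≈ (+-identityˡ 1#) (≤-respʳ-≈ (+-comm (n · 1#) 1#) (+-monoˡ-≤ 1# (0≤n·1 n)))

  n·1/n≈1 : ∀ n → .{{NonZero n}} → n · 1/ n ≈ 1#
  n·1/n≈1 (suc n) = ≈-trans (≈-sym (×-congʳ (suc n) (*-identityˡ _)))
    (≈-trans (≈-sym (×-assoc-* (suc n) 1# (1/ (suc n)))) (⁻¹-inverseʳ (suc n · 1#) (1+n·1≉0 n)))

  0≤1/n : ∀ n → .{{NonZero n}} → 0# ≤ 1/ n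
  0≤1/n n@(suc n′) with total 0# (1/ n)
  ... | inj₁ 0≤s = 0≤s
  ... | inj₂ s≤0 = contradiction (antisym 0≤1 1≤0) 0≉1
    where
    0≤-1 : 0# ≤ - 1#
    0≤-1 = ≤-respʳ-≈
      (≈-trans (≈-sym (-‿distribʳ-* (n · 1#) (1/ n)))
        (-‿cong (⁻¹-inverseʳ (n · 1#) (1+n·1≉0 n′))))
      (*-nonNeg (0≤n·1 n) (neg-nonNeg s≤0))
    1≤0 : 1# ≤ 0#
    1≤0 = ≤-respˡ-≈ (+-identityˡ 1#) (≤-respʳ-≈ (-‿inverseˡ 1#) (+-monoˡ-≤ 1# 0≤-1))

  []·-nonNeg : ∀ {p} {P : Set p} (P? : Dec P) {x} → 0# ≤ x → 0# ≤ [ P? ]· x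
  []·-nonNeg (yes _) 0≤x = 0≤x
  []·-nonNeg (no _)  _   = ≤-refl

------------------------------------------------------------------------
-- Ordered 3-uniform hypergraphs and their proper two-colourings

record OrderedHypergraph : Set where
  field
    #V #E         : ℕ
    edge          : Fin #E → Vec (Fin #V) 3
    edge-distinct : ∀ e → Unique (edge e)
    edge-inj      : Injective _≡_ _≡_ edge

Nonconstant : ∀ {n} → Vec Bool n → Set
Nonconstant u = ¬ (∀ i j → lookup u i ≡ lookup u j)

Nonconstant? : ∀ {n} → Decidable (Nonconstant {n})
Nonconstant? u = ¬? (all? λ i → all? λ j → lookup u i Bool.≟ lookup u j)

NAE₃ : Vec Bool 3 → Set
NAE₃ u = u ≢ false ∷ false ∷ false ∷ [] × u ≢ true ∷ true ∷ true ∷ []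

NAE₃? : Decidable NAE₃
NAE₃? u = ¬? (Vec.≡-dec Bool._≟_ u _) ×-dec ¬? (Vec.≡-dec Bool._≟_ u _)

IsMinority : Vec Bool 3 → Fin 3 → Set
IsMinority u j = ∃[ x ] lookup u j ≢ x × (∀ k → k ≢ j → lookup u k ≡ x)

private
  thirdIndex : ∀ (i j : Fin 3) → ∃[ k ] k ≢ i × k ≢ j
  thirdIndex = from-yes (all? {n = 3} λ i → all? {n = 3} λ j → any? {n = 3} λ k → ¬? (k Fin.≟ i) ×-dec ¬? (k Fin.≟ j))

IsMinority-unique : ∀ u {i j} → IsMinority u i → IsMinority u j → i ≡ j
IsMinority-unique u {i} {j} (x , uᵢ≢x , p) (y , uⱼ≢y , q) with i Fin.≟ j
... | yes i≡j = i≡j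
... | no  i≢j = let k , k≢i , k≢j = thirdIndex i j in
  contradiction (trans (q i i≢j) (trans (sym (q k k≢j)) (p k k≢i))) uᵢ≢x

IsMinority-not : ∀ u {j} → IsMinority u j → IsMinority (map not u) j
IsMinority-not u {j} (x , uⱼ≢x , p) =
    not x
  , (λ eq → uⱼ≢x (Bool.not-injective (trans (sym (Vec.lookup-map j not u)) eq)))
  , (λ k k≢j → trans (Vec.lookup-map k not u) (cong not (p k k≢j)))

minorityOf : ∀ u → Nonconstant u → ∃ (IsMinority u)
minorityOf (x ∷ y ∷ z ∷ []) nc with x Bool.≟ y | y Bool.≟ z | x Bool.≟ z
... | yes refl | yes refl | _        = contradiction (λ i j → trans (const i) (sym (const j))) nc
  where
  const : ∀ i → lookup (x ∷ x ∷ x ∷ []) i ≡ x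
  const = λ { 0F → refl ; 1F → refl ; 2F → refl }
... | yes refl | no y≢z   | _        = 2F , x , y≢z ∘ sym , λ
  { 0F _ → refl ; 1F _ → refl ; 2F 2≢2 → contradiction refl 2≢2 }
... | no x≢y   | yes refl | _        = 0F , y , x≢y , λ
  { 0F 0≢0 → contradiction refl 0≢0 ; 1F _ → refl ; 2F _ → refl }
... | no x≢y   | no y≢z   | yes refl = 1F , x , x≢y ∘ sym , λ
  { 0F _ → refl ; 1F 1≢1 → contradiction refl 1≢1 ; 2F _ → refl }
... | no x≢y   | no y≢z   | no x≢z   =
  contradiction (trans (Bool.¬-not x≢y) (sym (Bool.¬-not (y≢z ∘ sym)))) x≢z

module Colouring (H : OrderedHypergraph) where
  open OrderedHypergraph H

  Colouring : Set
  Colouring = Vec Bool #V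

  complement : Colouring → Colouring
  complement = map not

  colours : Colouring → Fin #E → Vec Bool 3
  colours c e = map (lookup c) (edge e)

  Proper : Colouring → Set
  Proper c = ∀ e → Nonconstant (colours c e)

  Proper? : Decidable Proper
  Proper? c = all? λ e → Nonconstant? (colours c e)

  -- Proper c is a negation, hence judgementally proof irrelevant, so an
  -- element of this type is determined by its underlying colouring.
  ProperColouring : Set
  ProperColouring = Σ Colouring Proper

  infix 4 _∼_

  _∼_ : ProperColouring → ProperColouring → Set
  (c , _) ∼ (d , _) = d ≡ c ⊎ d ≡ complement c

  complement-involutive : ∀ c → complement (complement c) ≡ c
  complement-involutive c =
    trans (sym (Vec.map-∘ not not c)) (trans (Vec.map-cong Bool.not-involutive c) (Vec.map-id c))

  colours-complement : ∀ c e → colours (complement c) e ≡ map not (colours c e)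
  colours-complement c e =
    trans (Vec.map-cong (λ v → Vec.lookup-map v not c) (edge e)) (Vec.map-∘ not (lookup c) (edge e))

  -- 𝒞(H): proper two-colourings modulo global complementation.
  𝒞 : Setoid _ _
  𝒞 = record
    { Carrier       = ProperColouring
    ; _≈_           = _∼_
    ; isEquivalence = record
        { refl  = inj₁ refl
        ; sym   = λ {S} {T} → ∼-sym {S} {T}
        ; trans = λ {S} {T} {U} → ∼-trans {S} {T} {U}
        }
    }
    where
    ∼-sym : ∀ {S T} → S ∼ T → T ∼ S
    ∼-sym             (inj₁ refl) = inj₁ refl
    ∼-sym {S = c , _} (inj₂ refl) = inj₂ (sym (complement-involutive c))

    ∼-trans : ∀ {S T U} → S ∼ T → T ∼ U → S ∼ U
    ∼-trans             (inj₁ refl) T∼U         = T∼U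
    ∼-trans             (inj₂ refl) (inj₁ refl) = inj₂ refl
    ∼-trans {S = c , _} (inj₂ refl) (inj₂ refl) = inj₁ (complement-involutive c)

  m : Fin #E → Func 𝒞 (setoid (Fin 3))
  m e = record { to = to ; cong = λ {S} {T} → to-cong {S} {T} }
    where
    to : ProperColouring → Fin 3
    to (c , proper) = proj₁ (minorityOf (colours c e) (proper e))

    to-isMinority : ∀ S → IsMinority (colours (proj₁ S) e) (to S)
    to-isMinority (c , proper) = proj₂ (minorityOf (colours c e) (proper e))

    to-cong : ∀ {S T} → S ∼ T → to S ≡ to T
    to-cong             (inj₁ refl) = refl
    to-cong {S@(c , _)} {T} (inj₂ refl) = IsMinority-unique (colours (complement c) e)
      (subst (λ u → IsMinority u (to S)) (sym (colours-complement c e))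
        (IsMinority-not (colours c e) (to-isMinority S)))
      (to-isMinority T)

  Frozen : Fin #E → Fin 3 → Set
  Frozen e j = ∀ (S : Setoid.Carrier 𝒞) → m e ⟨$⟩ S ≡ j

module Probability {c ℓ₁ ℓ₂} (K : OrderedField c ℓ₁ ℓ₂) (H : OrderedHypergraph) where
  open OrderedField K hiding (setoid)
  open Scalars K
  open Colouring H

  ∑-proper : (ProperColouring → Carrier) → Carrier
  ∑-proper f = ∑ λ c → summand c (Proper? c)
    module ∑-proper where
    summand : ∀ c → Dec (Proper c) → Carrier
    summand c (yes proper) = f (c , proper)
    summand c (no  _)      = 0#

  -- On the colourings themselves rather than on their complement classes; the
  -- two notions give the same minority probabilities, m e being defined on 𝒞.
  record Distribution : Set (c ⊔ ℓ₁ ⊔ ℓ₂) where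
    field
      mass       : ProperColouring → Carrier
      nonNeg     : ∀ S → 0# ≤ mass S
      normalised : ∑-proper mass ≈ 1#

  Pr : Distribution → ∀ {p} {P : Pred ProperColouring p} → Decidable P → Carrier
  Pr μ P? = ∑-proper λ S → [ P? S ]· Distribution.mass μ S

------------------------------------------------------------------------
-- Finite empirical models with outcomes in {0,1}

module _ {c ℓ₁ ℓ₂} (K : OrderedField c ℓ₁ ℓ₂) where
  open OrderedField K hiding (setoid) renaming (refl to ≈-refl; sym to ≈-sym; trans to ≈-trans)
  open Scalars K

  record EmpiricalModel : Set (Level.suc Level.zero ⊔ c ⊔ ℓ₁ ⊔ ℓ₂) where
    field
      Observable Context : Set
      #obs #ctx          : ℕ
      observables        : Observable ↔ Fin #obs
      contexts           : Context ↔ Fin #ctx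
      arity              : Context → ℕ
      scope              : ∀ C → Vec Observable (arity C)
      table              : ∀ C → Vec Bool (arity C) → Carrier
      table-nonNeg       : ∀ C u → 0# ≤ table C u
      table-normalised   : ∀ C → ∑ (table C) ≈ 1#

    -- Tabulated along the enumeration of the observables, so that distinct
    -- elements are distinct functions Observable → Bool.
    GlobalAssignment : Set
    GlobalAssignment = Vec Bool #obs

    value : GlobalAssignment → Observable → Bool
    value g x = lookup g (Inverse.to observables x)

    infix 7 _∣_

    _∣_ : GlobalAssignment → ∀ C → Vec Bool (arity C)
    g ∣ C = map (value g) (scope C)

    record Feasible (b : GlobalAssignment → Carrier) : Set (c ⊔ ℓ₁ ⊔ ℓ₂) where
      field
        nonNeg  : ∀ g → 0# ≤ b g
        bounded : ∀ C u → ∑ (λ g → [ Vec.≡-dec Bool._≟_ (g ∣ C) u ]· b g) ≤ table C u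

  -- NCF(M) = r, that is, r is the maximum in the definition of NCF(M).
  IsNCF : EmpiricalModel → Carrier → Set (c ⊔ ℓ₁ ⊔ ℓ₂)
  IsNCF M r = (∃[ b ] Feasible b × ∑ b ≈ r) × (∀ b → Feasible b → ∑ b ≤ r)
    where open EmpiricalModel M

  module _ (H : OrderedHypergraph) where
    open OrderedHypergraph H

    NonIsolated : Fin #V → Set
    NonIsolated v = ∃₂ λ e j → lookup (edge e) j ≡ v

    NonIsolated? : Decidable NonIsolated
    NonIsolated? v = any? λ e → any? λ j → lookup (edge e) j Fin.≟ v

    nonIsolated : List (Fin #V)
    nonIsolated = filter NonIsolated? (allFin #V)

    -- The position of v_j in the (repetition-free) list of non-isolated vertices.
    central : Fin #E → Fin 3 → Fin (length nonIsolated)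
    central e j = index (∈-filter⁺ NonIsolated? (∈-allFin (lookup (edge e) j)) (e , j , refl))

    -- Central observables on the left, the fresh observables v_j^e on the right.
    NAEObservable : Set
    NAEObservable = Fin (length nonIsolated) ⊎ (Fin #E × Fin 3)

    NAEContext : Set
    NAEContext = Fin #E ⊎ (Fin #E × Fin 3)

    private
      enumerate : ∀ {n} → (Fin n ⊎ (Fin #E × Fin 3)) ↔ Fin (n ℕ.+ #E ℕ.* 3)
      enumerate = ↔-sym (↔-trans +↔⊎ (↔-refl ⊎-↔ *↔×))

      six : ∀ s → ((0# + s) + (s + s)) + ((s + s) + (s + 0#)) ≈ 6 · s
      six s = ≈-trans (+-cong (+-congʳ (+-identityˡ s)) ≈-refl)
        (≈-trans (+-assoc s (s + s) _) (+-congˡ (≈-trans (+-assoc s s _)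
          (+-congˡ (+-congˡ (+-assoc s s _))))))

      two : ∀ s → (s + 0#) + (0# + s) ≈ 2 · s
      two s = +-cong (+-identityʳ s) (+-comm 0# s)

    NAEModel : EmpiricalModel
    NAEModel = record
      { Observable       = NAEObservable
      ; Context          = NAEContext
      ; observables      = enumerate
      ; contexts         = enumerate
      ; arity            = arity
      ; scope            = scope
      ; table            = table
      ; table-nonNeg     = table-nonNeg
      ; table-normalised = table-normalised
      }
      where
      arity : NAEContext → ℕ
      arity (inj₁ e)       = 3
      arity (inj₂ (e , j)) = 2

      scope : ∀ C → Vec NAEObservable (arity C)
      scope (inj₁ e)       = inj₂ (e , 0F) ∷ inj₂ (e , 1F) ∷ inj₂ (e , 2F) ∷ []
      scope (inj₂ (e , j)) = inj₁ (central e j) ∷ inj₂ (e , j) ∷ []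

      table : ∀ C → Vec Bool (arity C) → Carrier
      table (inj₁ e)       u = [ NAE₃? u ]· 1/ 6
      table (inj₂ (e , j)) u = [ lookup u 0F Bool.≟ lookup u 1F ]· 1/ 2

      table-nonNeg : ∀ C u → 0# ≤ table C u
      table-nonNeg (inj₁ e)       u = []·-nonNeg (NAE₃? u) (0≤1/n 6)
      table-nonNeg (inj₂ (e , j)) u = []·-nonNeg (lookup u 0F Bool.≟ lookup u 1F) (0≤1/n 2)

      table-normalised : ∀ C → ∑ (table C) ≈ 1#
      table-normalised (inj₁ e)       = ≈-trans (six (1/ 6)) (n·1/n≈1 6)
      table-normalised (inj₂ (e , j)) = ≈-trans (two (1/ 2)) (n·1/n≈1 2)

{-# OPTIONS --safe #-}
module Submission where

-- A feasible subdistribution lives on the assignments that agree along every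
-- context (v_j, v_j^e) and are NAE on every hyperedge, that is, on proper
-- colourings; there it is constrained by giving each outcome on each hyperedge
-- mass at most 1/6. Averaging with the complement turns this into: each
-- minority event has mass at most 1/3. So NCF is the largest total weight on
-- proper colourings for which every minority event weighs at most 1/3.
-- As the three events of a hyperedge partition the colourings, the total is at
-- most 1, with equality exactly when all the weights are 1/3. A point mass gives
-- 1/3, which a frozen event prevents from being exceeded; without frozen events
-- a multiple of the uniform distribution does better.

open import Defs
open import Axiom.UniquenessOfIdentityProofs using (module Decidable⇒UIP)
open import Algebra.Bundles using (CommutativeMonoid)
open import Data.Bool.Base using (Bool; true; false; not)
import Data.Bool.Properties as Bool
open import Data.Fin.Base using (Fin; fromℕ<)
open import Data.Fin.Patterns using (0F; 1F; 2F)
open import Data.Fin.Properties using (_≟_; all?; ¬∀⟶∃¬)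
open import Data.Fin.Subset.Properties using (anySubset?)
import Data.List.Base as List
open import Data.List.Membership.Propositional.Properties using (∈-filter⁺; ∈-allFin)
open import Data.List.Membership.Setoid.Properties using (unique⇒irrelevant)
open import Data.List.Relation.Unary.Any using (index)
open import Data.List.Relation.Unary.Any.Properties using (lookup-index)
open import Data.List.Relation.Unary.Unique.Propositional.Properties using (filter⁺; allFin⁺)
open import Data.Nat.Base using (zero; suc; NonZero; >-nonZero⁻¹)
open import Data.Product.Base using (∃; ∃₂; _×_; _,_; proj₁; proj₂)
open import Data.Sum.Base using (_⊎_; inj₁; inj₂)
open import Data.Unit.Base using (⊤; tt)
open import Data.Vec.Base using (Vec; []; _∷_; lookup; map; replicate; tabulate)
import Data.Vec.Properties as Vec
open import Function.Base using (_∘_)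
open import Function.Bundles using (_⇔_; mk⇔; _⟨$⟩_; Inverse)
open import Level using (_⊔_)
open import Relation.Binary.Bundles using (TotalOrder)
open import Relation.Binary.PropositionalEquality
  using (_≡_; _≢_; refl; sym; trans; cong; subst; setoid; module ≡-Reasoning)
open import Relation.Nullary using (¬_; Dec; yes; no)
open import Relation.Nullary.Decidable using (_×-dec_; ¬?; map′; decidable-stable)
open import Relation.Nullary.Negation using (contradiction)
open import Relation.Unary using (Decidable)

-- Arithmetic and order in an ordered field.

module OrderedFieldProperties {c ℓ₁ ℓ₂} (K : OrderedField c ℓ₁ ℓ₂) where
  open OrderedField K hiding (setoid)
    renaming (refl to ≈-refl; sym to ≈-sym; trans to ≈-trans)
  open Scalars K
  open import Algebra.Properties.Semiring.Mult semiring using (×-congʳ; ×-assoc-*)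

  totalOrder : TotalOrder c ℓ₁ ℓ₂
  totalOrder = record { isTotalOrder = isTotalOrder }

  open TotalOrder totalOrder public
    using (total; antisym) renaming (refl to ≤-refl; trans to ≤-trans; reflexive to ≤-reflexive)
  open TotalOrder totalOrder using (poset)
  module ≤-Reasoning where
    open import Relation.Binary.Reasoning.PartialOrder poset public
  open ≤-Reasoning

  +-monoʳ-≤ : ∀ {x y} z → x ≤ y → z + x ≤ z + y
  +-monoʳ-≤ {x} {y} z x≤y = begin
    z + x  ≈⟨ +-comm z x ⟩
    x + z  ≤⟨ +-monoˡ-≤ z x≤y ⟩
    y + z  ≈⟨ +-comm y z ⟩
    z + y  ∎

  +-mono-≤ : ∀ {x y u v} → x ≤ y → u ≤ v → x + u ≤ y + v
  +-mono-≤ x≤y u≤v = ≤-trans (+-monoˡ-≤ _ x≤y) (+-monoʳ-≤ _ u≤v)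

  x+y-y≈x : ∀ x y → x + y - y ≈ x
  x+y-y≈x x y = ≈-trans (+-assoc x y (- y)) (≈-trans (+-congˡ (-‿inverseʳ y)) (+-identityʳ x))

  +-cancelʳ-≤ : ∀ z {x y} → x + z ≤ y + z → x ≤ y
  +-cancelʳ-≤ z {x} {y} le = begin
    x          ≈⟨ x+y-y≈x x z ⟨
    x + z - z  ≤⟨ +-monoˡ-≤ (- z) le ⟩
    y + z - z  ≈⟨ x+y-y≈x y z ⟩
    y          ∎

  x≤x+y : ∀ {x y} → 0# ≤ y → x ≤ x + y
  x≤x+y {x} {y} 0≤y = begin
    x       ≈⟨ +-identityʳ x ⟨
    x + 0#  ≤⟨ +-monoʳ-≤ x 0≤y ⟩
    x + y   ∎

  y≤x+y : ∀ {x y} → 0# ≤ x → y ≤ x + y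
  y≤x+y {x} {y} 0≤x = ≤-trans (x≤x+y 0≤x) (≤-reflexive (+-comm y x))

  +-nonNeg : ∀ {x y} → 0# ≤ x → 0# ≤ y → 0# ≤ x + y
  +-nonNeg 0≤x 0≤y = ≤-trans 0≤x (x≤x+y 0≤y)

  x≤y⇒0≤y-x : ∀ {x y} → x ≤ y → 0# ≤ y - x
  x≤y⇒0≤y-x {x} {y} x≤y = begin
    0#     ≈⟨ -‿inverseʳ x ⟨
    x - x  ≤⟨ +-monoˡ-≤ (- x) x≤y ⟩
    y - x  ∎

  x-y+y≈x : ∀ x y → x - y + y ≈ x
  x-y+y≈x x y = ≈-trans (+-assoc x (- y) y) (≈-trans (+-congˡ (-‿inverseˡ y)) (+-identityʳ x))

  *-monoʳ-≤-nonNeg : ∀ {z} → 0# ≤ z → ∀ {x y} → x ≤ y → z * x ≤ z * y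
  *-monoʳ-≤-nonNeg {z} 0≤z {x} {y} x≤y = begin
    z * x                ≤⟨ y≤x+y (*-nonNeg 0≤z (x≤y⇒0≤y-x x≤y)) ⟩
    z * (y - x) + z * x  ≈⟨ distribˡ z (y - x) x ⟨
    z * (y - x + x)      ≈⟨ *-congˡ (x-y+y≈x y x) ⟩
    z * y                ∎

  1≰0 : ¬ (1# ≤ 0#)
  1≰0 1≤0 = 0≉1 (antisym 0≤1 1≤0)

  -- A nonpositive `y` would give `1# ≤ x * 0#`. This supplies the sign of the inverse `r ⁻¹` below.
  x*y≈1⇒0≤y : ∀ {x y} → 0# ≤ x → x * y ≈ 1# → 0# ≤ y
  x*y≈1⇒0≤y {x} {y} 0≤x xy≈1 with total 0# y
  ... | inj₁ 0≤y = 0≤y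
  ... | inj₂ y≤0 = contradiction 1≤0 1≰0
    where
    1≤0 : 1# ≤ 0#
    1≤0 = begin
      1#      ≈⟨ xy≈1 ⟨
      x * y   ≤⟨ *-monoʳ-≤-nonNeg 0≤x y≤0 ⟩
      x * 0#  ≈⟨ zeroʳ x ⟩
      0#      ∎

  -- Lets an identity between fractions be checked after clearing denominators: multiply `x` by
  -- `n · 1# * 1/ n` and regroup.
  1/-unique : ∀ n → .{{_ : NonZero n}} → ∀ {x} → n · x ≈ 1# → x ≈ 1/ n
  1/-unique n@(suc n′) {x} nx≈1 = begin-equality
    x                    ≈⟨ *-identityʳ x ⟨
    x * 1#               ≈⟨ *-congˡ (⁻¹-inverseʳ (n · 1#) (1+n·1≉0 n′)) ⟨
    x * (n · 1# * 1/ n)  ≈⟨ *-assoc x (n · 1#) (1/ n) ⟨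
    x * n · 1# * 1/ n    ≈⟨ *-congʳ (*-comm x (n · 1#)) ⟩
    n · 1# * x * 1/ n    ≈⟨ *-congʳ (×-assoc-* n 1# x) ⟩
    n · (1# * x) * 1/ n  ≈⟨ *-congʳ (×-congʳ n (*-identityˡ x)) ⟩
    n · x * 1/ n         ≈⟨ *-congʳ nx≈1 ⟩
    1# * 1/ n            ≈⟨ *-identityˡ (1/ n) ⟩
    1/ n                 ∎

  3·x≈x+[x+x] : ∀ x → 3 · x ≈ x + (x + x)
  3·x≈x+[x+x] x = +-congˡ (+-congˡ (+-identityʳ x))

  1/3+[1/3+1/3]≈1 : 1/ 3 + (1/ 3 + 1/ 3) ≈ 1#
  1/3+[1/3+1/3]≈1 = ≈-trans (≈-sym (3·x≈x+[x+x] (1/ 3))) (n·1/n≈1 3)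

  1/2+1/2≈1 : 1/ 2 + 1/ 2 ≈ 1#
  1/2+1/2≈1 = ≈-trans (+-congˡ (≈-sym (+-identityʳ (1/ 2)))) (n·1/n≈1 2)

  -- A minority position is shared by exactly two tuples of `NAE₃`, so this converts outcome masses
  -- into minority masses.
  1/6+1/6≈1/3 : 1/ 6 + 1/ 6 ≈ 1/ 3
  1/6+1/6≈1/3 = 1/-unique 3 (begin-equality
    3 · (s + s)                    ≈⟨ 3·x≈x+[x+x] (s + s) ⟩
    s + s + (s + s + (s + s))      ≈⟨ +-assoc s s _ ⟩
    s + (s + (s + s + (s + s)))    ≈⟨ +-congˡ (+-congˡ (+-assoc s s _)) ⟩
    s + (s + (s + (s + (s + s))))  ≈⟨ +-congˡ (+-congˡ (+-congˡ (3·x≈x+[x+x] s))) ⟨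
    6 · s                          ≈⟨ n·1/n≈1 6 ⟩
    1#                             ∎)
    where s = 1/ 6

  1/2*[x+x]≈x : ∀ x → 1/ 2 * (x + x) ≈ x
  1/2*[x+x]≈x x = begin-equality
    1/ 2 * (x + x)       ≈⟨ distribˡ (1/ 2) x x ⟩
    1/ 2 * x + 1/ 2 * x  ≈⟨ distribʳ x (1/ 2) (1/ 2) ⟨
    (1/ 2 + 1/ 2) * x    ≈⟨ *-congʳ 1/2+1/2≈1 ⟩
    1# * x               ≈⟨ *-identityˡ x ⟩
    x                    ∎

  -- From `a + b ≤ x + y ≤ x + b`, cancelling `b` leaves `a ≤ x`.
  +-squeezeˡ : ∀ {x y a b} → x ≤ a → y ≤ b → a + b ≤ x + y → x ≈ a
  +-squeezeˡ x≤a y≤b a+b≤x+y =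
    antisym x≤a (+-cancelʳ-≤ _ (≤-trans a+b≤x+y (+-monoʳ-≤ _ y≤b)))

  total₃ : (Fin 3 → Carrier) → Carrier
  total₃ p = p 0F + (p 1F + p 2F)

  total₃-mono-≤ : ∀ {p q} → (∀ j → p j ≤ q j) → total₃ p ≤ total₃ q
  total₃-mono-≤ p≤q = +-mono-≤ (p≤q 0F) (+-mono-≤ (p≤q 1F) (p≤q 2F))

  -- If the total of the upper bounds is reached, no single bound has any slack. Applied with all
  -- bounds equal to `1/ 3`.
  total₃-squeeze : ∀ {p q} → (∀ j → p j ≤ q j) → total₃ q ≤ total₃ p → ∀ j → p j ≈ q j
  total₃-squeeze {p} {q} p≤q q≤p = λ
    { 0F → +-squeezeˡ (p≤q 0F) (+-mono-≤ (p≤q 1F) (p≤q 2F)) q≤p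
    ; 1F → +-squeezeˡ (p≤q 1F) (p≤q 2F) tail
    ; 2F → +-squeezeˡ (p≤q 2F) (p≤q 1F) (begin
             q 2F + q 1F  ≈⟨ +-comm _ _ ⟩
             q 1F + q 2F  ≤⟨ tail ⟩
             p 1F + p 2F  ≈⟨ +-comm _ _ ⟩
             p 2F + p 1F  ∎)
    }
    where
    -- The first coordinate is removed by cancelling `p 0F`, which is at most `q 0F`; what remains
    -- is a squeeze of two terms.
    tail : q 1F + q 2F ≤ p 1F + p 2F
    tail = +-cancelʳ-≤ (p 0F) (begin
      q 1F + q 2F + p 0F    ≤⟨ +-monoʳ-≤ _ (p≤q 0F) ⟩
      q 1F + q 2F + q 0F    ≈⟨ +-comm _ _ ⟩
      q 0F + (q 1F + q 2F)  ≤⟨ q≤p ⟩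
      p 0F + (p 1F + p 2F)  ≈⟨ +-comm _ _ ⟩
      p 1F + p 2F + p 0F    ∎)

-- Sums over Boolean vectors, indicators and pushforwards.

module SumProperties {c ℓ₁ ℓ₂} (K : OrderedField c ℓ₁ ℓ₂) where
  open OrderedField K hiding (setoid)
    renaming (refl to ≈-refl; sym to ≈-sym; trans to ≈-trans; zero to *-zero)
  open Scalars K
  open OrderedFieldProperties K
  open ≤-Reasoning
  open import Algebra.Properties.CommutativeSemigroup
    (CommutativeMonoid.commutativeSemigroup +-commutativeMonoid) using (interchange)

  ∑-cong : ∀ {n} {f g : Vec Bool n → Carrier} → (∀ v → f v ≈ g v) → ∑ f ≈ ∑ g
  ∑-cong {zero}  f≈g = f≈g []
  ∑-cong {suc n} f≈g = +-cong (∑-cong (f≈g ∘ (false ∷_))) (∑-cong (f≈g ∘ (true ∷_)))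

  ∑-mono-≤ : ∀ {n} {f g : Vec Bool n → Carrier} → (∀ v → f v ≤ g v) → ∑ f ≤ ∑ g
  ∑-mono-≤ {zero}  f≤g = f≤g []
  ∑-mono-≤ {suc n} f≤g = +-mono-≤ (∑-mono-≤ (f≤g ∘ (false ∷_))) (∑-mono-≤ (f≤g ∘ (true ∷_)))

  ∑-zero : ∀ n → ∑ {n} (λ _ → 0#) ≈ 0#
  ∑-zero zero    = ≈-refl
  ∑-zero (suc n) = ≈-trans (+-cong (∑-zero n) (∑-zero n)) (+-identityʳ 0#)

  ∑-≈0 : ∀ {n} {f : Vec Bool n → Carrier} → (∀ v → f v ≈ 0#) → ∑ f ≈ 0#
  ∑-≈0 {n} f≈0 = ≈-trans (∑-cong f≈0) (∑-zero n)

  ∑-nonNeg : ∀ {n} {f : Vec Bool n → Carrier} → (∀ v → 0# ≤ f v) → 0# ≤ ∑ f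
  ∑-nonNeg {n} 0≤f = ≤-trans (≤-reflexive (≈-sym (∑-zero n))) (∑-mono-≤ 0≤f)

  ∑-+ : ∀ {n} (f g : Vec Bool n → Carrier) → ∑ (λ v → f v + g v) ≈ ∑ f + ∑ g
  ∑-+ {zero}  f g = ≈-refl
  ∑-+ {suc n} f g = ≈-trans (+-cong (∑-+ (f ∘ (false ∷_)) _) (∑-+ (f ∘ (true ∷_)) _)) (interchange _ _ _ _)

  ∑-*ˡ : ∀ {n} x (f : Vec Bool n → Carrier) → ∑ (λ v → x * f v) ≈ x * ∑ f
  ∑-*ˡ {zero}  x f = ≈-refl
  ∑-*ˡ {suc n} x f = ≈-trans (+-cong (∑-*ˡ x (f ∘ (false ∷_))) (∑-*ˡ x (f ∘ (true ∷_)))) (≈-sym (distribˡ x _ _))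

  ∑-swap : ∀ {m n} (f : Vec Bool m → Vec Bool n → Carrier) →
           ∑ (λ u → ∑ (λ v → f u v)) ≈ ∑ (λ v → ∑ (λ u → f u v))
  ∑-swap {zero}  f = ≈-refl
  ∑-swap {suc m} f =
    ≈-trans (+-cong (∑-swap (f ∘ (false ∷_))) (∑-swap (f ∘ (true ∷_))))
      (≈-sym (∑-+ (λ v → ∑ (λ u → f (false ∷ u) v)) (λ v → ∑ (λ u → f (true ∷ u) v))))

  module _ {p} {P : Set p} where
    []·-yes : (P? : Dec P) → P → ∀ {x} → [ P? ]· x ≈ x
    []·-yes (yes _) _ = ≈-refl
    []·-yes (no ¬p) p = contradiction p ¬p

    []·-no : (P? : Dec P) → ¬ P → ∀ {x} → [ P? ]· x ≈ 0#
    []·-no (yes p) ¬p = contradiction p ¬p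
    []·-no (no _)  _  = ≈-refl

    []·-0 : (P? : Dec P) → ∀ {x} → x ≈ 0# → [ P? ]· x ≈ 0#
    []·-0 (yes _) x≈0 = x≈0
    []·-0 (no _)  _   = ≈-refl

    []·-cong : (P? : Dec P) → ∀ {x y} → x ≈ y → [ P? ]· x ≈ [ P? ]· y
    []·-cong (yes _) x≈y = x≈y
    []·-cong (no _)  _   = ≈-refl

    []·-≤ : (P? : Dec P) → ∀ {x} → 0# ≤ x → [ P? ]· x ≤ x
    []·-≤ (yes _) _   = ≤-refl
    []·-≤ (no _)  0≤x = 0≤x

    []·-+ : (P? : Dec P) → ∀ x y → [ P? ]· (x + y) ≈ [ P? ]· x + [ P? ]· y
    []·-+ (yes _) x y = ≈-refl
    []·-+ (no _)  x y = ≈-sym (+-identityʳ 0#)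

    []·-*ˡ : (P? : Dec P) → ∀ x y → [ P? ]· (x * y) ≈ x * [ P? ]· y
    []·-*ˡ (yes _) x y = ≈-refl
    []·-*ˡ (no _)  x y = ≈-sym (zeroʳ x)

    []·-∑ : (P? : Dec P) → ∀ {n} (f : Vec Bool n → Carrier) → [ P? ]· ∑ f ≈ ∑ (λ v → [ P? ]· f v)
    []·-∑ (yes _) f = ≈-refl
    []·-∑ (no _)  {n} f = ≈-sym (∑-zero n)

  module _ {p q} {P : Set p} {Q : Set q} where
    []·-⇔ : (P? : Dec P) (Q? : Dec Q) → (P → Q) → (Q → P) → ∀ {x} → [ P? ]· x ≈ [ Q? ]· x
    []·-⇔ (yes p) Q? P⇒Q Q⇒P = ≈-sym ([]·-yes Q? (P⇒Q p))
    []·-⇔ (no ¬p) Q? P⇒Q Q⇒P = ≈-sym ([]·-no Q? (¬p ∘ Q⇒P))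

    []·-comm : (P? : Dec P) (Q? : Dec Q) → ∀ {x} → [ P? ]· [ Q? ]· x ≈ [ Q? ]· [ P? ]· x
    []·-comm (yes _) Q? = ≈-refl
    []·-comm (no _)  Q? = ≈-sym ([]·-0 Q? ≈-refl)

  module _ {p q r} {P : Set p} {Q : Set q} {R : Set r} where
    -- At most one of the two indicators on the left is nonzero. Summed over colourings, this will
    -- count a colouring and its complement together without counting any weight twice.
    []·-disjoint-≤ : (P? : Dec P) (Q? : Dec Q) (R? : Dec R) → (P → R) → (Q → R) → ¬ (P × Q) →
                     ∀ {x} → 0# ≤ x → [ P? ]· x + [ Q? ]· x ≤ [ R? ]· x
    []·-disjoint-≤ (yes p) (yes q) R? P⇒R Q⇒R ¬P×Q     0≤x = contradiction (p , q) ¬P×Q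
    []·-disjoint-≤ (yes p) (no _)  R? P⇒R Q⇒R ¬P×Q {x} 0≤x = ≤-reflexive (≈-trans (+-identityʳ x) (≈-sym ([]·-yes R? (P⇒R p))))
    []·-disjoint-≤ (no _)  (yes q) R? P⇒R Q⇒R ¬P×Q {x} 0≤x = ≤-reflexive (≈-trans (+-identityˡ x) (≈-sym ([]·-yes R? (Q⇒R q))))
    []·-disjoint-≤ (no _)  (no _)  R? P⇒R Q⇒R ¬P×Q     0≤x = ≤-trans (≤-reflexive (+-identityʳ 0#)) ([]·-nonNeg R? 0≤x)

    -- The union bound at a single point.
    []·-cover-≤ : (P? : Dec P) (Q? : Dec Q) (R? : Dec R) → (P → Q ⊎ R) →
                  ∀ {x} → 0# ≤ x → [ P? ]· x ≤ [ Q? ]· x + [ R? ]· x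
    []·-cover-≤ (no _)  Q? R? P⇒Q⊎R 0≤x = +-nonNeg ([]·-nonNeg Q? 0≤x) ([]·-nonNeg R? 0≤x)
    []·-cover-≤ (yes p) Q? R? P⇒Q⊎R 0≤x with P⇒Q⊎R p
    ... | inj₁ q = ≤-trans (≤-reflexive (≈-sym ([]·-yes Q? q))) (x≤x+y ([]·-nonNeg R? 0≤x))
    ... | inj₂ r = ≤-trans (≤-reflexive (≈-sym ([]·-yes R? r))) (y≤x+y ([]·-nonNeg Q? 0≤x))

  infix 4 _≟ᵛ_

  _≟ᵛ_ : ∀ {n} (u v : Vec Bool n) → Dec (u ≡ v)
  _≟ᵛ_ = Vec.≡-dec Bool._≟_

  ∑-δ : ∀ {n} (u : Vec Bool n) (f : Vec Bool n → Carrier) → ∑ (λ v → [ u ≟ᵛ v ]· f v) ≈ f u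
  ∑-δ []          f = ≈-refl
  ∑-δ {suc n} (false ∷ u) f = begin-equality
    ∑ (λ v → [ false ∷ u ≟ᵛ false ∷ v ]· f (false ∷ v)) + ∑ (λ v → [ false ∷ u ≟ᵛ true ∷ v ]· f (true ∷ v))
      -- In the other half the heads differ, so the indicators compute to `0#` and `∑-zero` applies
      -- as it stands.
      ≈⟨ +-cong (∑-cong λ v → []·-⇔ (false ∷ u ≟ᵛ false ∷ v) (u ≟ᵛ v) Vec.∷-injectiveʳ (cong (false ∷_)))
                (∑-zero n) ⟩
    ∑ (λ v → [ u ≟ᵛ v ]· f (false ∷ v)) + 0#  ≈⟨ +-identityʳ _ ⟩
    ∑ (λ v → [ u ≟ᵛ v ]· f (false ∷ v))       ≈⟨ ∑-δ u (f ∘ (false ∷_)) ⟩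
    f (false ∷ u)                             ∎
  ∑-δ {suc n} (true ∷ u)  f = begin-equality
    ∑ (λ v → [ true ∷ u ≟ᵛ false ∷ v ]· f (false ∷ v)) + ∑ (λ v → [ true ∷ u ≟ᵛ true ∷ v ]· f (true ∷ v))
      ≈⟨ +-cong (∑-zero n)
                (∑-cong λ v → []·-⇔ (true ∷ u ≟ᵛ true ∷ v) (u ≟ᵛ v) Vec.∷-injectiveʳ (cong (true ∷_))) ⟩
    0# + ∑ (λ v → [ u ≟ᵛ v ]· f (true ∷ v))  ≈⟨ +-identityˡ _ ⟩
    ∑ (λ v → [ u ≟ᵛ v ]· f (true ∷ v))       ≈⟨ ∑-δ u (f ∘ (true ∷_)) ⟩
    f (true ∷ u)                             ∎

  term≤∑ : ∀ {n} {f : Vec Bool n → Carrier} → (∀ v → 0# ≤ f v) → ∀ u → f u ≤ ∑ f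
  term≤∑ {f = f} 0≤f u = begin
    f u                          ≈⟨ ∑-δ u f ⟨
    ∑ (λ v → [ u ≟ᵛ v ]· f v)  ≤⟨ ∑-mono-≤ (λ v → []·-≤ (u ≟ᵛ v) (0≤f v)) ⟩
    ∑ f                          ∎

  -- The pushforward of the weight `w` along `φ`. It carries weights from colourings to global
  -- assignments and back.
  push : ∀ {m n} → (Vec Bool m → Vec Bool n) → (Vec Bool m → Carrier) → Vec Bool n → Carrier
  push φ w v = ∑ λ u → [ φ u ≟ᵛ v ]· w u

  module _ {m n} (φ : Vec Bool m → Vec Bool n) (w : Vec Bool m → Carrier) where
    push-nonNeg : (∀ u → 0# ≤ w u) → ∀ v → 0# ≤ push φ w v
    push-nonNeg 0≤w v = ∑-nonNeg λ u → []·-nonNeg (φ u ≟ᵛ v) (0≤w u)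

    -- Change of variables: after interchanging the sums, each `u` contributes only at `v ≡ φ u`.
    ∑-push-[] : ∀ {p} {P : Vec Bool n → Set p} (P? : Decidable P) →
                ∑ (λ v → [ P? v ]· push φ w v) ≈ ∑ (λ u → [ P? (φ u) ]· w u)
    ∑-push-[] P? = begin-equality
      ∑ (λ v → [ P? v ]· push φ w v)                      ≈⟨ ∑-cong (λ v → []·-∑ (P? v) λ u → [ φ u ≟ᵛ v ]· w u) ⟩
      ∑ (λ v → ∑ (λ u → [ P? v ]· [ φ u ≟ᵛ v ]· w u))  ≈⟨ ∑-swap (λ v u → [ P? v ]· [ φ u ≟ᵛ v ]· w u) ⟩
      ∑ (λ u → ∑ (λ v → [ P? v ]· [ φ u ≟ᵛ v ]· w u))  ≈⟨ ∑-cong (λ u → ∑-cong λ v → []·-comm (P? v) (φ u ≟ᵛ v)) ⟩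
      ∑ (λ u → ∑ (λ v → [ φ u ≟ᵛ v ]· [ P? v ]· w u))  ≈⟨ ∑-cong (λ u → ∑-δ (φ u) λ v → [ P? v ]· w u) ⟩
      ∑ (λ u → [ P? (φ u) ]· w u)                         ∎

    ∑-push : ∑ (push φ w) ≈ ∑ w
    ∑-push = ∑-push-[] {P = λ _ → ⊤} (λ _ → yes _)

-- Minority positions of Boolean triples.

map₃ : ∀ {a b} {A : Set a} {B : Set b} (f : A → B) (u : Vec A 3) →
       map f u ≡ f (lookup u 0F) ∷ f (lookup u 1F) ∷ f (lookup u 2F) ∷ []
map₃ f (x ∷ y ∷ z ∷ []) = refl

map-not≢id : ∀ {n} (u : Vec Bool (suc n)) → map not u ≢ u
map-not≢id (x ∷ u) eq = Bool.not-¬ refl (sym (Vec.∷-injectiveˡ eq))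

-- For fixed `j`, the values at `false` and `true` are the two outcomes with minority position `j`,
-- so the six tuples of `NAE₃` fall into three pairs.
minorityVec : Fin 3 → Bool → Vec Bool 3
minorityVec 0F x = x ∷ not x ∷ not x ∷ []
minorityVec 1F x = not x ∷ x ∷ not x ∷ []
minorityVec 2F x = not x ∷ not x ∷ x ∷ []

isMinority-minorityVec : ∀ j x → IsMinority (minorityVec j x) j
isMinority-minorityVec j x = not x , lemma₁ j , lemma₂ j
  where
  lemma₁ : ∀ j → lookup (minorityVec j x) j ≢ not x
  lemma₁ 0F = Bool.not-¬ refl
  lemma₁ 1F = Bool.not-¬ refl
  lemma₁ 2F = Bool.not-¬ refl
  lemma₂ : ∀ j k → k ≢ j → lookup (minorityVec j x) k ≡ not x
  lemma₂ 0F 0F 0≢0 = contradiction refl 0≢0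
  lemma₂ 0F 1F _   = refl
  lemma₂ 0F 2F _   = refl
  lemma₂ 1F 0F _   = refl
  lemma₂ 1F 1F 1≢1 = contradiction refl 1≢1
  lemma₂ 1F 2F _   = refl
  lemma₂ 2F 0F _   = refl
  lemma₂ 2F 1F _   = refl
  lemma₂ 2F 2F 2≢2 = contradiction refl 2≢2

-- With two colours, the common value of the other two entries can only be the negation of the
-- minority entry.
isMinority⇒≡minorityVec : ∀ u j → IsMinority u j → u ≡ minorityVec j (lookup u j)
isMinority⇒≡minorityVec (x ∷ y ∷ z ∷ []) 0F (t , x≢t , p)
  rewrite p 1F (λ ()) | p 2F (λ ()) | Bool.¬-not (x≢t ∘ sym) = refl
isMinority⇒≡minorityVec (x ∷ y ∷ z ∷ []) 1F (t , y≢t , p)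
  rewrite p 0F (λ ()) | p 2F (λ ()) | Bool.¬-not (y≢t ∘ sym) = refl
isMinority⇒≡minorityVec (x ∷ y ∷ z ∷ []) 2F (t , z≢t , p)
  rewrite p 0F (λ ()) | p 1F (λ ()) | Bool.¬-not (z≢t ∘ sym) = refl

isMinority⇒≡false⊎≡true : ∀ u j → IsMinority u j → u ≡ minorityVec j false ⊎ u ≡ minorityVec j true
isMinority⇒≡false⊎≡true u j min with lookup u j | isMinority⇒≡minorityVec u j min
... | false | eq = inj₁ eq
... | true  | eq = inj₂ eq

-- The existential in `IsMinority` is decided by comparing `u` with the only triple that has its
-- `j`-th entry in the minority at `j`.
IsMinority? : ∀ u j → Dec (IsMinority u j)
IsMinority? u j = map′
  (λ eq → subst (λ v → IsMinority v j) (sym eq) (isMinority-minorityVec j (lookup u j)))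
  (isMinority⇒≡minorityVec u j)
  (Vec.≡-dec Bool._≟_ u (minorityVec j (lookup u j)))

NAE₃⇒Nonconstant : ∀ u → NAE₃ u → Nonconstant u
NAE₃⇒Nonconstant (x ∷ y ∷ z ∷ []) (≢000 , ≢111) const with x | const 0F 1F | const 0F 2F
... | false | refl | refl = ≢000 refl
... | true  | refl | refl = ≢111 refl

Nonconstant⇒NAE₃ : ∀ u → Nonconstant u → NAE₃ u
Nonconstant⇒NAE₃ u nonconst = (λ { refl → nonconst (replicated false) }) , (λ { refl → nonconst (replicated true) })
  where
  replicated : ∀ (x : Bool) i j → lookup (replicate 3 x) i ≡ lookup (replicate 3 x) j
  replicated x i j = trans (Vec.lookup-replicate i x) (sym (Vec.lookup-replicate j x))

-- Minority positions under complementation, and frozen events.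

module Colourings (H : OrderedHypergraph) where
  open OrderedHypergraph H
  open Colouring H

  isMinority-m : ∀ S e → IsMinority (colours (proj₁ S) e) (m e ⟨$⟩ S)
  isMinority-m (c , proper) e = proj₂ (minorityOf (colours c e) (proper e))

  isMinority⇒m≡ : ∀ S e {j} → IsMinority (colours (proj₁ S) e) j → m e ⟨$⟩ S ≡ j
  isMinority⇒m≡ S e = IsMinority-unique (colours (proj₁ S) e) (isMinority-m S e)

  m≡⇒isMinority : ∀ S e {j} → m e ⟨$⟩ S ≡ j → IsMinority (colours (proj₁ S) e) j
  m≡⇒isMinority S e refl = isMinority-m S e

  complement-isMinority⁻ : ∀ c e {j} → IsMinority (colours (complement c) e) j → IsMinority (colours c e) j
  complement-isMinority⁻ c e {j} min = subst (λ d → IsMinority (colours d e) j) (complement-involutive c)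
    (subst (λ u → IsMinority u j) (sym (colours-complement (complement c) e)) (IsMinority-not (colours (complement c) e) min))

  complement-proper⁺ : ∀ c → Proper c → Proper (complement c)
  complement-proper⁺ c proper e const = proper e λ i j → Bool.not-injective (begin
    not (lookup (colours c e) i)        ≡⟨ Vec.lookup-map i not (colours c e) ⟨
    lookup (map not (colours c e)) i    ≡⟨ cong (λ u → lookup u i) (colours-complement c e) ⟨
    lookup (colours (complement c) e) i ≡⟨ const i j ⟩
    lookup (colours (complement c) e) j ≡⟨ cong (λ u → lookup u j) (colours-complement c e) ⟩
    lookup (map not (colours c e)) j    ≡⟨ Vec.lookup-map j not (colours c e) ⟩
    not (lookup (colours c e) j)        ∎)
    where open ≡-Reasoning

  colours≢colours-complement : ∀ c e → colours (complement c) e ≢ colours c e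
  colours≢colours-complement c e eq = map-not≢id (colours c e) (trans (sym (colours-complement c e)) eq)

  -- A witnessed failure of `Frozen`, phrased on plain colourings so that it can be decided by
  -- finite search.
  Unfrozen : Fin #E → Fin 3 → Set
  Unfrozen e j = ∃ λ c → Proper c × ¬ IsMinority (colours c e) j

  Unfrozen? : ∀ e j → Dec (Unfrozen e j)
  -- A colouring is a Boolean vector, that is, a subset of the vertices, so `anySubset?` runs
  -- through all colourings.
  Unfrozen? e j = anySubset? λ c → Proper? c ×-dec ¬? (IsMinority? (colours c e) j)

  ¬Unfrozen⇒Frozen : ∀ {e j} → ¬ Unfrozen e j → Frozen e j
  ¬Unfrozen⇒Frozen {e} {j} ¬unfrozen S@(c , proper) =
    isMinority⇒m≡ S e (decidable-stable (IsMinority? (colours c e) j) λ ¬min → ¬unfrozen (c , proper , ¬min))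

-- Weights on proper colourings and the noncontextual fraction.

module Fractions {c ℓ₁ ℓ₂} (K : OrderedField c ℓ₁ ℓ₂) (H : OrderedHypergraph) where
  open OrderedField K hiding (setoid)
    renaming (refl to ≈-refl; sym to ≈-sym; trans to ≈-trans)
  open Scalars K
  open OrderedFieldProperties K
  open ≤-Reasoning
  open SumProperties K
  open OrderedHypergraph H
  open Colouring H
  open Colourings H
  open Probability K H
  open EmpiricalModel (NAEModel K H)

  -- Functions on all colourings that vanish off the proper ones stand in for functions on
  -- `ProperColouring`, so that `∑` and `push` apply directly.
  record ProperWeight (w : Colouring → Carrier) : Set (c ⊔ ℓ₁ ⊔ ℓ₂) where
    field
      nonNeg    : ∀ c → 0# ≤ w c
      supported : ∀ c → ¬ Proper c → w c ≈ 0#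

  minorityMass : (Colouring → Carrier) → Fin #E → Fin 3 → Carrier
  minorityMass w e j = ∑ λ c → [ IsMinority? (colours c e) j ]· w c

  minorityMass-cong : ∀ {w w′} → (∀ c → w c ≈ w′ c) → ∀ e j → minorityMass w e j ≈ minorityMass w′ e j
  minorityMass-cong w≈w′ e j = ∑-cong λ c → []·-cong (IsMinority? (colours c e) j) (w≈w′ c)

  []·-isMinority-total₃ : ∀ u → Nonconstant u → ∀ x → total₃ (λ j → [ IsMinority? u j ]· x) ≈ x
  []·-isMinority-total₃ u nonconst x with minorityOf u nonconst
  ... | 0F , min = ≈-trans (+-cong ([]·-yes (IsMinority? u 0F) min) (+-cong
                     ([]·-no (IsMinority? u 1F) λ min′ → contradiction (IsMinority-unique u min min′) λ ())
                     ([]·-no (IsMinority? u 2F) λ min′ → contradiction (IsMinority-unique u min min′) λ ())))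
                   (≈-trans (+-congˡ (+-identityʳ 0#)) (+-identityʳ x))
  ... | 1F , min = ≈-trans (+-cong
                     ([]·-no (IsMinority? u 0F) λ min′ → contradiction (IsMinority-unique u min min′) λ ())
                     (+-cong ([]·-yes (IsMinority? u 1F) min)
                     ([]·-no (IsMinority? u 2F) λ min′ → contradiction (IsMinority-unique u min min′) λ ())))
                   (≈-trans (+-identityˡ _) (+-identityʳ x))
  ... | 2F , min = ≈-trans (+-cong
                     ([]·-no (IsMinority? u 0F) λ min′ → contradiction (IsMinority-unique u min min′) λ ())
                     (+-cong ([]·-no (IsMinority? u 1F) λ min′ → contradiction (IsMinority-unique u min min′) λ ())
                     ([]·-yes (IsMinority? u 2F) min)))
                   (≈-trans (+-identityˡ _) (+-identityˡ x))

  module _ {w} (proper-w : ProperWeight w) where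
    open ProperWeight proper-w

    -- On a proper colouring exactly one of the three indicators is active; on any other colouring
    -- both sides vanish.
    minorityMass-total₃ : ∀ e → total₃ (minorityMass w e) ≈ ∑ w
    minorityMass-total₃ e = begin-equality
      total₃ (minorityMass w e)
        ≈⟨ ≈-trans (+-congˡ (≈-sym (∑-+ (ind 1F) (ind 2F)))) (≈-sym (∑-+ (ind 0F) λ c → ind 1F c + ind 2F c)) ⟩
      ∑ (λ c → total₃ λ j → [ IsMinority? (colours c e) j ]· w c)  ≈⟨ ∑-cong (λ c → pointwise c (Proper? c)) ⟩
      ∑ w                                                            ∎
      where
      ind : Fin 3 → Colouring → Carrier
      ind j c = [ IsMinority? (colours c e) j ]· w c
      pointwise : ∀ c → Dec (Proper c) → total₃ (λ j → ind j c) ≈ w c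
      pointwise c (yes proper) = []·-isMinority-total₃ (colours c e) (proper e) (w c)
      pointwise c (no ¬proper) = ≈-trans
        (+-cong (zeros 0F) (≈-trans (+-cong (zeros 1F) (zeros 2F)) (+-identityʳ 0#)))
        (≈-trans (+-identityʳ 0#) (≈-sym (supported c ¬proper)))
        where
        zeros : ∀ j → ind j c ≈ 0#
        zeros j = []·-0 (IsMinority? (colours c e) j) (supported c ¬proper)

    minorityMass≤1/3⇒∑≤1 : ∀ e → (∀ j → minorityMass w e j ≤ 1/ 3) → ∑ w ≤ 1#
    minorityMass≤1/3⇒∑≤1 e mass≤1/3 = begin
      ∑ w                        ≈⟨ minorityMass-total₃ e ⟨
      total₃ (minorityMass w e)  ≤⟨ total₃-mono-≤ mass≤1/3 ⟩
      total₃ (λ _ → 1/ 3)        ≈⟨ 1/3+[1/3+1/3]≈1 ⟩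
      1#                         ∎

    frozen⇒minorityMass : ∀ {e j} → Frozen e j → minorityMass w e j ≈ ∑ w
    frozen⇒minorityMass {e} {j} frozen = ∑-cong λ c → pointwise c (Proper? c)
      where
      pointwise : ∀ c → Dec (Proper c) → [ IsMinority? (colours c e) j ]· w c ≈ w c
      pointwise c (yes proper) = []·-yes (IsMinority? (colours c e) j) (m≡⇒isMinority (c , proper) e (frozen (c , proper)))
      pointwise c (no ¬proper) = ≈-trans ([]·-0 (IsMinority? (colours c e) j) (supported c ¬proper)) (≈-sym (supported c ¬proper))

  -- Feasible subdistributions from weights on colourings

  -- Central and fresh observables of a vertex both take its colour, so a lifted colouring agrees
  -- along every context `inj₂ (e , j)`.
  colourOf : Colouring → Observable → Bool
  colourOf c (inj₁ i)       = lookup c (List.lookup (nonIsolated K H) i)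
  colourOf c (inj₂ (e , j)) = lookup c (lookup (edge e) j)

  lift : Colouring → GlobalAssignment
  lift c = tabulate (colourOf c ∘ Inverse.from observables)

  value-lift : ∀ c x → value (lift c) x ≡ colourOf c x
  value-lift c x = trans (Vec.lookup∘tabulate _ (Inverse.to observables x))
    (cong (colourOf c) (Inverse.strictlyInverseʳ observables x))

  lookup-central : ∀ e j → List.lookup (nonIsolated K H) (central K H e j) ≡ lookup (edge e) j
  lookup-central e j = sym (lookup-index (∈-filter⁺ (NonIsolated? K H) (∈-allFin (lookup (edge e) j)) (e , j , refl)))

  lift-∣-edge : ∀ c e → lift c ∣ inj₁ e ≡ colours c e
  lift-∣-edge c e = trans (Vec.map-cong (value-lift c) (scope (inj₁ e))) (sym (map₃ (lookup c) (edge e)))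

  lift-∣-central : ∀ c e j → let x = lookup c (lookup (edge e) j) in lift c ∣ inj₂ (e , j) ≡ x ∷ x ∷ []
  lift-∣-central c e j = trans (Vec.map-cong (value-lift c) (scope (inj₂ (e , j))))
    (cong (λ v → lookup c v ∷ lookup c (lookup (edge e) j) ∷ []) (lookup-central e j))

  module _ {w} (proper-w : ProperWeight w) (mass≤1/3 : ∀ e j → minorityMass w e j ≤ 1/ 3) where
    open ProperWeight proper-w

    private
      half : Colouring → Carrier
      half c = 1/ 2 * w c

      half-nonNeg : ∀ c → 0# ≤ half c
      half-nonNeg c = *-nonNeg (0≤1/n 2) (nonNeg c)

      -- Half of each weight goes to the lift of `c` and half to the lift of its complement. This
      -- divides the mass of a minority event evenly between its two outcomes.
      b : GlobalAssignment → Carrier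
      b g = push lift half g + push (lift ∘ complement) half g

      -- Twice the contribution of `c` to the marginal of `b` at `u`; `marginal` pulls out the
      -- factor `1/ 2`.
      matching : ∀ C → Vec Bool (arity C) → Colouring → Carrier
      matching C u c = [ lift c ∣ C ≟ᵛ u ]· w c + [ lift (complement c) ∣ C ≟ᵛ u ]· w c

      marginal : ∀ C u → ∑ (λ g → [ g ∣ C ≟ᵛ u ]· b g) ≈ 1/ 2 * ∑ (matching C u)
      marginal C u = begin-equality
        ∑ (λ g → [ g ∣ C ≟ᵛ u ]· b g)
          ≈⟨ ∑-cong (λ g → []·-+ (g ∣ C ≟ᵛ u) (push lift half g) (push (lift ∘ complement) half g)) ⟩
        ∑ (λ g → [ g ∣ C ≟ᵛ u ]· push lift half g + [ g ∣ C ≟ᵛ u ]· push (lift ∘ complement) half g)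
          ≈⟨ ∑-+ (λ g → [ g ∣ C ≟ᵛ u ]· push lift half g) _ ⟩
        ∑ (λ g → [ g ∣ C ≟ᵛ u ]· push lift half g) + ∑ (λ g → [ g ∣ C ≟ᵛ u ]· push (lift ∘ complement) half g)
          ≈⟨ +-cong (∑-push-[] lift half (λ g → g ∣ C ≟ᵛ u)) (∑-push-[] (lift ∘ complement) half (λ g → g ∣ C ≟ᵛ u)) ⟩
        ∑ (λ c → [ lift c ∣ C ≟ᵛ u ]· half c) + ∑ (λ c → [ lift (complement c) ∣ C ≟ᵛ u ]· half c)
          ≈⟨ ∑-+ (λ c → [ lift c ∣ C ≟ᵛ u ]· half c) _ ⟨
        ∑ (λ c → [ lift c ∣ C ≟ᵛ u ]· half c + [ lift (complement c) ∣ C ≟ᵛ u ]· half c)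
          ≈⟨ ∑-cong (λ c → ≈-trans (+-cong ([]·-*ˡ (lift c ∣ C ≟ᵛ u) (1/ 2) (w c))
                                           ([]·-*ˡ (lift (complement c) ∣ C ≟ᵛ u) (1/ 2) (w c)))
                                   (≈-sym (distribˡ (1/ 2) _ _))) ⟩
        ∑ (λ c → 1/ 2 * matching C u c)  ≈⟨ ∑-*ˡ (1/ 2) (matching C u) ⟩
        1/ 2 * ∑ (matching C u)          ∎

      -- The factor `1/ 2` from the averaging is absorbed by the doubled target `t + t`.
      bound : ∀ C u {t} → ∑ (matching C u) ≤ t + t → t ≤ table C u → ∑ (λ g → [ g ∣ C ≟ᵛ u ]· b g) ≤ table C u
      bound C u {t} le t≤table = begin
        ∑ (λ g → [ g ∣ C ≟ᵛ u ]· b g)  ≈⟨ marginal C u ⟩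
        1/ 2 * ∑ (matching C u)         ≤⟨ *-monoʳ-≤-nonNeg (0≤1/n 2) le ⟩
        1/ 2 * (t + t)                  ≈⟨ 1/2*[x+x]≈x t ⟩
        t                               ≤⟨ t≤table ⟩
        table C u                       ∎

      -- The complement of a proper colouring is proper, so an outcome missed by the lifts of proper
      -- colourings is missed by both halves of `b`, and its marginal is zero.
      bound-0 : ∀ C u → (∀ c → Proper c → lift c ∣ C ≢ u) → ∑ (λ g → [ g ∣ C ≟ᵛ u ]· b g) ≤ table C u
      bound-0 C u missed = bound C u
        (≤-reflexive (≈-trans (∑-≈0 λ c → pointwise c (Proper? c)) (≈-sym (+-identityʳ 0#)))) (table-nonNeg C u)
        where
        pointwise : ∀ c → Dec (Proper c) → matching C u c ≈ 0#
        pointwise c (yes proper) = ≈-trans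
          (+-cong ([]·-no (lift c ∣ C ≟ᵛ u) (missed c proper))
                  ([]·-no (lift (complement c) ∣ C ≟ᵛ u) (missed (complement c) (complement-proper⁺ c proper))))
          (+-identityʳ 0#)
        pointwise c (no ¬proper) = ≈-trans
          (+-cong ([]·-0 (lift c ∣ C ≟ᵛ u) (supported c ¬proper))
                  ([]·-0 (lift (complement c) ∣ C ≟ᵛ u) (supported c ¬proper)))
          (+-identityʳ 0#)

      bounded : ∀ C u → ∑ (λ g → [ g ∣ C ≟ᵛ u ]· b g) ≤ table C u
      bounded (inj₁ e) u = bounded-edge (NAE₃? u)
        where
        bounded-edge : Dec (NAE₃ u) → ∑ (λ g → [ g ∣ inj₁ e ≟ᵛ u ]· b g) ≤ table (inj₁ e) u
        bounded-edge (yes nae) = bound (inj₁ e) u matching≤ (≤-reflexive (≈-sym ([]·-yes (NAE₃? u) nae)))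
          where
          j   = proj₁ (minorityOf u (NAE₃⇒Nonconstant u nae))
          min = proj₂ (minorityOf u (NAE₃⇒Nonconstant u nae))
          isMin : ∀ c → lift c ∣ inj₁ e ≡ u → IsMinority (colours c e) j
          isMin c eq = subst (λ v → IsMinority v j) (trans (sym eq) (lift-∣-edge c e)) min
          matching≤ : ∑ (matching (inj₁ e) u) ≤ 1/ 6 + 1/ 6
          matching≤ = begin
            ∑ (matching (inj₁ e) u)
              -- If `c` or its complement produces `u`, then `c` lies in the event `(e , j)`, as
              -- complementation preserves the minority position. They cannot both produce `u`,
              -- because their colours on `e` differ.
              ≤⟨ ∑-mono-≤ (λ c → []·-disjoint-≤
                   (lift c ∣ inj₁ e ≟ᵛ u) (lift (complement c) ∣ inj₁ e ≟ᵛ u) (IsMinority? (colours c e) j)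
                   (isMin c) (λ eq → complement-isMinority⁻ c e (isMin (complement c) eq))
                   (λ (eq , eq′) → colours≢colours-complement c e
                     (trans (sym (lift-∣-edge (complement c) e)) (trans eq′ (trans (sym eq) (lift-∣-edge c e)))))
                   (nonNeg c)) ⟩
            minorityMass w e j  ≤⟨ mass≤1/3 e j ⟩
            1/ 3                ≈⟨ 1/6+1/6≈1/3 ⟨
            1/ 6 + 1/ 6         ∎
        bounded-edge (no ¬nae) = bound-0 (inj₁ e) u λ c proper eq →
          ¬nae (subst NAE₃ (trans (sym (lift-∣-edge c e)) eq) (Nonconstant⇒NAE₃ (colours c e) (proper e)))
      bounded C@(inj₂ (e , j)) u@(x ∷ y ∷ []) = bounded-central (x Bool.≟ y)
        where
        v = lookup (edge e) j
        x≡ : ∀ c → lift c ∣ C ≡ u → lookup c v ≡ x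
        x≡ c eq = Vec.∷-injectiveˡ (trans (sym (lift-∣-central c e j)) eq)
        bounded-central : Dec (x ≡ y) → ∑ (λ g → [ g ∣ C ≟ᵛ u ]· b g) ≤ table C u
        bounded-central (yes x≡y) = bound C u matching≤ (≤-reflexive (≈-sym ([]·-yes (x Bool.≟ y) x≡y)))
          where
          matching≤ : ∑ (matching C u) ≤ 1/ 2 + 1/ 2
          matching≤ = begin
            ∑ (matching C u)
              -- A colouring and its complement differ at `v`, so only one of them can match `u`;
              -- the total weight then bounds the sum.
              ≤⟨ ∑-mono-≤ (λ c → []·-disjoint-≤
                   (lift c ∣ C ≟ᵛ u) (lift (complement c) ∣ C ≟ᵛ u) (yes tt) _ _
                   (λ (eq , eq′) → Bool.not-¬ (trans (x≡ (complement c) eq′) (sym (x≡ c eq))) (Vec.lookup-map v not c))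
                   (nonNeg c)) ⟩
            ∑ w          ≤⟨ minorityMass≤1/3⇒∑≤1 proper-w e (mass≤1/3 e) ⟩
            1#           ≈⟨ 1/2+1/2≈1 ⟨
            1/ 2 + 1/ 2  ∎
        bounded-central (no x≢y) = bound-0 C u λ c proper eq →
          x≢y (trans (sym (x≡ c eq)) (Vec.∷-injectiveˡ (Vec.∷-injectiveʳ (trans (sym (lift-∣-central c e j)) eq))))

    weight⇒feasible : ∃ λ b → Feasible b × ∑ b ≈ ∑ w
    weight⇒feasible = b
      , record
        { nonNeg  = λ g → +-nonNeg (push-nonNeg lift half half-nonNeg g)
                                   (push-nonNeg (lift ∘ complement) half half-nonNeg g)
        ; bounded = bounded
        }
      , (begin-equality
        ∑ b                                                     ≈⟨ ∑-+ (push lift half) _ ⟩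
        ∑ (push lift half) + ∑ (push (lift ∘ complement) half)  ≈⟨ +-cong (∑-push lift half) (∑-push (lift ∘ complement) half) ⟩
        ∑ half + ∑ half                                         ≈⟨ +-cong (∑-*ˡ (1/ 2) w) (∑-*ˡ (1/ 2) w) ⟩
        1/ 2 * ∑ w + 1/ 2 * ∑ w                                 ≈⟨ distribˡ (1/ 2) (∑ w) (∑ w) ⟨
        1/ 2 * (∑ w + ∑ w)                                      ≈⟨ 1/2*[x+x]≈x (∑ w) ⟩
        ∑ w                                                     ∎)

  -- Weights on colourings from feasible subdistributions

  centralOf : ∀ {v} → NonIsolated K H v → Fin (List.length (nonIsolated K H))
  centralOf {v} p = index (∈-filter⁺ (NonIsolated? K H) (∈-allFin v) p)

  -- A vertex may lie on several hyperedges, and each incidence yields its own proof of membership.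
  -- The list is repetition-free, so all of them point to the same central observable.
  centralOf-irrelevant : ∀ {v} (p q : NonIsolated K H v) → centralOf p ≡ centralOf q
  centralOf-irrelevant {v} p q = cong index (unique⇒irrelevant (setoid (Fin #V)) (Decidable⇒UIP.≡-irrelevant _≟_)
    (filter⁺ (NonIsolated? K H) (allFin⁺ #V)) (∈-filter⁺ (NonIsolated? K H) (∈-allFin v) p) (∈-filter⁺ (NonIsolated? K H) (∈-allFin v) q))

  colourAt : GlobalAssignment → ∀ {v} → Dec (NonIsolated K H v) → Bool
  colourAt g (yes p) = value g (inj₁ (centralOf p))
  -- A default colour for isolated vertices: they lie on no hyperedge, so no `colours c e` depends
  -- on it.
  colourAt g (no _)  = false

  pull : GlobalAssignment → Colouring
  pull g = tabulate λ v → colourAt g (NonIsolated? K H v)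

  lookup-pull : ∀ g e j → lookup (pull g) (lookup (edge e) j) ≡ value g (inj₁ (central K H e j))
  lookup-pull g e j = trans (Vec.lookup∘tabulate _ (lookup (edge e) j)) (colourAt-edge (NonIsolated? K H (lookup (edge e) j)))
    where
    colourAt-edge : (d : Dec (NonIsolated K H (lookup (edge e) j))) → colourAt g d ≡ value g (inj₁ (central K H e j))
    colourAt-edge (yes p) = cong (value g ∘ inj₁) (centralOf-irrelevant p (e , j , refl))
    colourAt-edge (no ¬p) = contradiction (e , j , refl) ¬p

  -- These are the assignments whose restriction to every context has nonzero mass in the table.
  record Consistent (g : GlobalAssignment) : Set where
    field
      nae   : ∀ e → NAE₃ (g ∣ inj₁ e)
      agree : ∀ e j → value g (inj₁ (central K H e j)) ≡ value g (inj₂ (e , j))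

    colours-pull : ∀ e → colours (pull g) e ≡ g ∣ inj₁ e
    colours-pull e = trans (map₃ (lookup (pull g)) (edge e))
      (cong₃ (λ x y z → x ∷ y ∷ z ∷ []) (colour 0F) (colour 1F) (colour 2F))
      where
      colour : ∀ j → lookup (pull g) (lookup (edge e) j) ≡ value g (inj₂ (e , j))
      colour j = trans (lookup-pull g e j) (agree e j)
      cong₃ : ∀ {A B : Set} (f : A → A → A → B) {x x′ y y′ z z′} → x ≡ x′ → y ≡ y′ → z ≡ z′ → f x y z ≡ f x′ y′ z′
      cong₃ f refl refl refl = refl

    pull-proper : Proper (pull g)
    pull-proper e = subst Nonconstant (sym (colours-pull e)) (NAE₃⇒Nonconstant (g ∣ inj₁ e) (nae e))

  module _ {b} (feasible : Feasible b) where
    open Feasible feasible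

    -- The marginal at `g ∣ C` is a sum of nonnegative terms containing `b g`, and it is bounded by
    -- a table entry that is zero.
    forbidden⇒≈0 : ∀ g C → table C (g ∣ C) ≈ 0# → b g ≈ 0#
    forbidden⇒≈0 g C table≈0 = antisym (begin
      b g                                     ≈⟨ []·-yes (g ∣ C ≟ᵛ g ∣ C) refl ⟨
      [ g ∣ C ≟ᵛ g ∣ C ]· b g                ≤⟨ term≤∑ (λ h → []·-nonNeg (h ∣ C ≟ᵛ g ∣ C) (nonNeg h)) g ⟩
      ∑ (λ h → [ h ∣ C ≟ᵛ g ∣ C ]· b h)      ≤⟨ bounded C (g ∣ C) ⟩
      table C (g ∣ C)                         ≈⟨ table≈0 ⟩
      0#                                      ∎) (nonNeg g)

    consistent⊎≈0 : ∀ g → Consistent g ⊎ b g ≈ 0#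
    consistent⊎≈0 g with all? (λ e → NAE₃? (g ∣ inj₁ e))
                       | all? (λ e → all? λ j → value g (inj₁ (central K H e j)) Bool.≟ value g (inj₂ (e , j)))
    ... | yes nae | yes agree = inj₁ (record { nae = nae ; agree = agree })
    ... | no ¬nae | _ =
      let e , ¬naeₑ = ¬∀⟶∃¬ _ _ (λ e → NAE₃? (g ∣ inj₁ e)) ¬nae
      in inj₂ (forbidden⇒≈0 g (inj₁ e) ([]·-no (NAE₃? (g ∣ inj₁ e)) ¬naeₑ))
    ... | yes _ | no ¬agree =
      let e , ¬agreeₑ  = ¬∀⟶∃¬ _ _ (λ e → all? λ j → value g (inj₁ (central K H e j)) Bool.≟ value g (inj₂ (e , j))) ¬agree
          j , ¬agreeₑⱼ = ¬∀⟶∃¬ _ _ (λ j → value g (inj₁ (central K H e j)) Bool.≟ value g (inj₂ (e , j))) ¬agreeₑ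
      in inj₂ (forbidden⇒≈0 g (inj₂ (e , j)) ([]·-no (value g (inj₁ (central K H e j)) Bool.≟ value g (inj₂ (e , j))) ¬agreeₑⱼ))

    -- An assignment that pulls back to an improper colouring is inconsistent, so it carries no
    -- mass.
    pull-properWeight : ProperWeight (push pull b)
    pull-properWeight = record
      { nonNeg    = push-nonNeg pull b nonNeg
      ; supported = λ c ¬proper → ∑-≈0 λ g → vanishes c ¬proper g (consistent⊎≈0 g)
      }
      where
      vanishes : ∀ c → ¬ Proper c → ∀ g → Consistent g ⊎ b g ≈ 0# → [ pull g ≟ᵛ c ]· b g ≈ 0#
      vanishes c ¬proper g (inj₁ consistent) = []·-no (pull g ≟ᵛ c)
        λ eq → ¬proper (subst Proper eq (Consistent.pull-proper consistent))
      vanishes c ¬proper g (inj₂ b≈0) = []·-0 (pull g ≟ᵛ c) b≈0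

    -- On consistent assignments the event `(e , j)` is covered by the two outcomes
    -- `minorityVec j false` and `minorityVec j true`, each of marginal mass at most `1/ 6`.
    pull-minorityMass≤1/3 : ∀ e j → minorityMass (push pull b) e j ≤ 1/ 3
    pull-minorityMass≤1/3 e j = begin
      minorityMass (push pull b) e j
        ≈⟨ ∑-push-[] pull b (λ c → IsMinority? (colours c e) j) ⟩
      ∑ (λ g → [ IsMinority? (colours (pull g) e) j ]· b g)
        ≤⟨ ∑-mono-≤ (λ g → pointwise g (consistent⊎≈0 g)) ⟩
      ∑ (λ g → outcome false g + outcome true g)  ≈⟨ ∑-+ (outcome false) (outcome true) ⟩
      ∑ (outcome false) + ∑ (outcome true)        ≤⟨ +-mono-≤ (outcome≤1/6 false) (outcome≤1/6 true) ⟩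
      1/ 6 + 1/ 6                                 ≈⟨ 1/6+1/6≈1/3 ⟩
      1/ 3                                        ∎
      where
      outcome : Bool → GlobalAssignment → Carrier
      outcome x g = [ g ∣ inj₁ e ≟ᵛ minorityVec j x ]· b g

      outcome≤1/6 : ∀ x → ∑ (outcome x) ≤ 1/ 6
      outcome≤1/6 x = ≤-trans (bounded (inj₁ e) (minorityVec j x)) ([]·-≤ (NAE₃? (minorityVec j x)) (0≤1/n 6))

      pointwise : ∀ g → Consistent g ⊎ b g ≈ 0# →
                  [ IsMinority? (colours (pull g) e) j ]· b g ≤ outcome false g + outcome true g
      pointwise g (inj₁ consistent) = []·-cover-≤ (IsMinority? (colours (pull g) e) j)
        (g ∣ inj₁ e ≟ᵛ minorityVec j false) (g ∣ inj₁ e ≟ᵛ minorityVec j true)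
        (λ min → isMinority⇒≡false⊎≡true (g ∣ inj₁ e) j
          (subst (λ u → IsMinority u j) (Consistent.colours-pull consistent e) min))
        (nonNeg g)
      pointwise g (inj₂ b≈0) = ≤-trans (≤-reflexive ([]·-0 (IsMinority? (colours (pull g) e) j) b≈0))
        (+-nonNeg ([]·-nonNeg (g ∣ inj₁ e ≟ᵛ minorityVec j false) (nonNeg g))
                  ([]·-nonNeg (g ∣ inj₁ e ≟ᵛ minorityVec j true) (nonNeg g)))

    feasible⇒∑≤1 : Fin #E → ∑ b ≤ 1#
    feasible⇒∑≤1 e = ≤-trans (≤-reflexive (≈-sym (∑-push pull b)))
      (minorityMass≤1/3⇒∑≤1 pull-properWeight e (pull-minorityMass≤1/3 e))

  -- Distributions on proper colourings and the value 1.

  extend : (ProperColouring → Carrier) → Colouring → Carrier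
  extend f c = ∑-proper.summand f c (Proper? c)

  extend-properWeight : ∀ {f} → (∀ S → 0# ≤ f S) → ProperWeight (extend f)
  extend-properWeight {f} 0≤f = record
    { nonNeg    = λ c → summand-nonNeg c (Proper? c)
    ; supported = λ c → summand-supported c (Proper? c)
    }
    where
    summand-nonNeg : ∀ c d → 0# ≤ ∑-proper.summand f c d
    summand-nonNeg c (yes proper) = 0≤f (c , proper)
    summand-nonNeg c (no _)       = ≤-refl
    summand-supported : ∀ c d → ¬ Proper c → ∑-proper.summand f c d ≈ 0#
    summand-supported c (yes proper) ¬proper = contradiction proper ¬proper
    summand-supported c (no _)       _       = ≈-refl

  extend-restrict : ∀ {w} → ProperWeight w → ∀ c → extend (w ∘ proj₁) c ≈ w c
  extend-restrict {w} proper-w c = summand-restrict (Proper? c)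
    where
    summand-restrict : ∀ d → ∑-proper.summand (w ∘ proj₁) c d ≈ w c
    summand-restrict (yes _)      = ≈-refl
    summand-restrict (no ¬proper) = ≈-sym (ProperWeight.supported proper-w c ¬proper)

  -- Translates probabilities phrased with `m` into minority masses: on proper colourings the two
  -- events are equivalent, and elsewhere both summands are zero.
  ∑-proper-minority : ∀ f e j → ∑-proper (λ S → [ (m e ⟨$⟩ S) ≟ j ]· f S) ≈ minorityMass (extend f) e j
  ∑-proper-minority f e j = ∑-cong λ c → pointwise c (Proper? c)
    where
    pointwise : ∀ c d → ∑-proper.summand (λ S → [ (m e ⟨$⟩ S) ≟ j ]· f S) c d
                      ≈ [ IsMinority? (colours c e) j ]· ∑-proper.summand f c d
    pointwise c (yes proper) = []·-⇔ ((m e ⟨$⟩ (c , proper)) ≟ j) (IsMinority? (colours c e) j)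
      (m≡⇒isMinority (c , proper) e) (isMinority⇒m≡ (c , proper) e)
    pointwise c (no _)       = ≈-sym ([]·-0 (IsMinority? (colours c e) j) ≈-refl)

  NCF≡1⇒uniform : IsNCF K (NAEModel K H) 1# →
                  ∃ λ (μ : Distribution) → ∀ e j → Pr μ (λ S → (m e ⟨$⟩ S) ≟ j) ≈ 1/ 3
  NCF≡1⇒uniform ((b , feasible , ∑b≈1) , _) = μ , λ e j → begin-equality
      Pr μ (λ S → (m e ⟨$⟩ S) ≟ j)           ≈⟨ ∑-proper-minority (w ∘ proj₁) e j ⟩
      minorityMass (extend (w ∘ proj₁)) e j  ≈⟨ minorityMass-cong (extend-restrict proper-w) e j ⟩
      minorityMass w e j                     ≈⟨ total₃-squeeze (pull-minorityMass≤1/3 feasible e) (1≤total₃ e) j ⟩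
      1/ 3                                   ∎
    where
    w = push pull b
    proper-w = pull-properWeight feasible
    ∑w≈1 : ∑ w ≈ 1#
    ∑w≈1 = ≈-trans (∑-push pull b) ∑b≈1
    μ : Distribution
    μ = record
      { mass       = w ∘ proj₁
      ; nonNeg     = ProperWeight.nonNeg proper-w ∘ proj₁
      -- `∑-proper` unfolds to the sum of the extension by zero, which recovers `w` because `w`
      -- vanishes off the proper colourings.
      ; normalised = ≈-trans (∑-cong (extend-restrict proper-w)) ∑w≈1
      }
    1≤total₃ : ∀ e → total₃ (λ _ → 1/ 3) ≤ total₃ (minorityMass w e)
    1≤total₃ e = ≤-reflexive (≈-trans 1/3+[1/3+1/3]≈1
      (≈-trans (≈-sym ∑w≈1) (≈-sym (minorityMass-total₃ proper-w e))))

  uniform⇒NCF≡1 : Fin #E → (∃ λ (μ : Distribution) → ∀ e j → Pr μ (λ S → (m e ⟨$⟩ S) ≟ j) ≈ 1/ 3) →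
                  IsNCF K (NAEModel K H) 1#
  uniform⇒NCF≡1 e₀ (μ , Pr≈1/3) =
    let b , feasible , ∑b≈∑w = weight⇒feasible (extend-properWeight nonNeg)
          λ e j → ≤-reflexive (≈-trans (≈-sym (∑-proper-minority mass e j)) (Pr≈1/3 e j))
    in (b , feasible , ≈-trans ∑b≈∑w normalised) , λ _ feasible′ → feasible⇒∑≤1 feasible′ e₀
    where open Distribution μ

  -- Frozen events and the value 1/3.

  frozen⇒NCF≡1/3 : ProperColouring → (∃₂ λ e j → Frozen e j) → IsNCF K (NAEModel K H) (1/ 3)
  frozen⇒NCF≡1/3 (c₀ , proper₀) (e , j , frozen) =
    let b , feasible , ∑b≈∑w = weight⇒feasible δ-proper λ e j → begin
          minorityMass δ e j  ≤⟨ ∑-mono-≤ (λ c → []·-≤ (IsMinority? (colours c e) j) (δ-nonNeg c)) ⟩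
          ∑ δ                 ≈⟨ ∑-δ c₀ (λ _ → 1/ 3) ⟩
          1/ 3                ∎
    in (b , feasible , ≈-trans ∑b≈∑w (∑-δ c₀ (λ _ → 1/ 3))) , λ b′ feasible′ → begin
         ∑ b′                             ≈⟨ ∑-push pull b′ ⟨
         ∑ (push pull b′)                 ≈⟨ frozen⇒minorityMass (pull-properWeight feasible′) frozen ⟨
         minorityMass (push pull b′) e j  ≤⟨ pull-minorityMass≤1/3 feasible′ e j ⟩
         1/ 3                             ∎
    where
    δ : Colouring → Carrier
    δ c = [ c₀ ≟ᵛ c ]· 1/ 3
    δ-nonNeg : ∀ c → 0# ≤ δ c
    δ-nonNeg c = []·-nonNeg (c₀ ≟ᵛ c) (0≤1/n 3)
    δ-proper : ProperWeight δ
    δ-proper = record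
      { nonNeg    = δ-nonNeg
      ; supported = λ c ¬proper → []·-no (c₀ ≟ᵛ c) λ eq → ¬proper (subst Proper eq proper₀)
      }

  -- If no minority event holds on all of the t proper colourings, then each
  -- holds on at most t − 1 of them, so that every proper colouring can be
  -- given the weight 1/(3(t − 1)), for a total exceeding 1/3.
  module _ (e₀ : Fin #E) (unfrozen : ∀ e j → Unfrozen e j) where
    private
      count : Colouring → Carrier
      count c = [ Proper? c ]· 1#

      count-nonNeg : ∀ c → 0# ≤ count c
      count-nonNeg c = []·-nonNeg (Proper? c) 0≤1

      count-proper : ProperWeight count
      count-proper = record
        { nonNeg    = count-nonNeg
        ; supported = λ c ¬proper → []·-no (Proper? c) ¬proper
        }

      t r s : Carrier
      t = ∑ count
      r = t - 1#
      s = 1/ 3 * r ⁻¹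

      -- The witness of `Unfrozen e j` is a proper colouring outside the event, so its indicator can
      -- be added to that of the event without exceeding `count`.
      minority+1≤t : ∀ e j → minorityMass count e j + 1# ≤ t
      minority+1≤t e j = begin
        minorityMass count e j + 1#
          ≈⟨ +-congˡ (∑-δ c₁ (λ _ → 1#)) ⟨
        minorityMass count e j + ∑ (λ c → [ c₁ ≟ᵛ c ]· 1#)
          ≈⟨ ∑-+ (λ c → [ IsMinority? (colours c e) j ]· count c) _ ⟨
        ∑ (λ c → [ IsMinority? (colours c e) j ]· count c + [ c₁ ≟ᵛ c ]· 1#)
          ≤⟨ ∑-mono-≤ (λ c → pointwise c (Proper? c)) ⟩
        t ∎
        where
        c₁       = proj₁ (unfrozen e j)
        proper₁  = proj₁ (proj₂ (unfrozen e j))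
        ¬min₁    = proj₂ (proj₂ (unfrozen e j))
        -- Abstracting the decision `d` lets one case split reduce `count c` on both sides.
        pointwise : ∀ c (d : Dec (Proper c)) →
                    [ IsMinority? (colours c e) j ]· [ d ]· 1# + [ c₁ ≟ᵛ c ]· 1# ≤ [ d ]· 1#
        pointwise c (yes _) = []·-disjoint-≤ (IsMinority? (colours c e) j) (c₁ ≟ᵛ c) (yes tt) _ _
          (λ { (min , refl) → ¬min₁ min }) 0≤1
        pointwise c (no ¬proper) = ≤-reflexive (≈-trans
          (+-cong ([]·-0 (IsMinority? (colours c e) j) ≈-refl)
                  ([]·-no (c₁ ≟ᵛ c) λ eq → ¬proper (subst Proper eq proper₁)))
          (+-identityʳ 0#))

      minority≤r : ∀ e j → minorityMass count e j ≤ r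
      minority≤r e j = +-cancelʳ-≤ 1# (≤-trans (minority+1≤t e j) (≤-reflexive (≈-sym (x-y+y≈x t 1#))))

      0≤minority : ∀ e j → 0# ≤ minorityMass count e j
      0≤minority e j = ∑-nonNeg λ c → []·-nonNeg (IsMinority? (colours c e) j) (count-nonNeg c)

      0≤r : 0# ≤ r
      0≤r = ≤-trans (0≤minority e₀ 0F) (minority≤r e₀ 0F)

      -- If `r` vanished, all three minority masses on `e₀` would be at most zero, and hence so
      -- would their total `t`; yet `t` is at least `1#`.
      r≉0 : ¬ r ≈ 0#
      r≉0 r≈0 = 1≰0 (begin
        1#                               ≤⟨ y≤x+y (0≤minority e₀ 0F) ⟩
        minorityMass count e₀ 0F + 1#    ≤⟨ minority+1≤t e₀ 0F ⟩
        t                                ≈⟨ minorityMass-total₃ count-proper e₀ ⟨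
        total₃ (minorityMass count e₀)   ≤⟨ total₃-mono-≤ (λ j → ≤-trans (minority≤r e₀ j) (≤-reflexive r≈0)) ⟩
        0# + (0# + 0#)                   ≈⟨ ≈-trans (+-identityˡ _) (+-identityˡ 0#) ⟩
        0#                               ∎)

      0≤s : 0# ≤ s
      0≤s = *-nonNeg (0≤1/n 3) (x*y≈1⇒0≤y 0≤r (⁻¹-inverseʳ r r≉0))

      s*r≈1/3 : s * r ≈ 1/ 3
      s*r≈1/3 = begin-equality
        1/ 3 * r ⁻¹ * r    ≈⟨ *-assoc (1/ 3) (r ⁻¹) r ⟩
        1/ 3 * (r ⁻¹ * r)  ≈⟨ *-congˡ (≈-trans (*-comm (r ⁻¹) r) (⁻¹-inverseʳ r r≉0)) ⟩
        1/ 3 * 1#          ≈⟨ *-identityʳ (1/ 3) ⟩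
        1/ 3               ∎

      w : Colouring → Carrier
      w c = s * count c

      w-proper : ProperWeight w
      w-proper = record
        { nonNeg    = λ c → *-nonNeg 0≤s (count-nonNeg c)
        ; supported = λ c ¬proper → ≈-trans (*-congˡ (ProperWeight.supported count-proper c ¬proper)) (zeroʳ s)
        }

      w-minority≤1/3 : ∀ e j → minorityMass w e j ≤ 1/ 3
      w-minority≤1/3 e j = begin
        minorityMass w e j          ≈⟨ ∑-cong (λ c → []·-*ˡ (IsMinority? (colours c e) j) s (count c)) ⟩
        ∑ (λ c → s * [ IsMinority? (colours c e) j ]· count c)
                                    ≈⟨ ∑-*ˡ s (λ c → [ IsMinority? (colours c e) j ]· count c) ⟩
        s * minorityMass count e j  ≤⟨ *-monoʳ-≤-nonNeg 0≤s (minority≤r e j) ⟩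
        s * r                       ≈⟨ s*r≈1/3 ⟩
        1/ 3                        ∎

      ∑w≈s+1/3 : ∑ w ≈ s + 1/ 3
      ∑w≈s+1/3 = begin-equality
        ∑ w             ≈⟨ ∑-*ˡ s count ⟩
        s * t           ≈⟨ *-congˡ (x-y+y≈x t 1#) ⟨
        s * (r + 1#)    ≈⟨ distribˡ s r 1# ⟩
        s * r + s * 1#  ≈⟨ +-cong s*r≈1/3 (*-identityʳ s) ⟩
        1/ 3 + s        ≈⟨ +-comm (1/ 3) s ⟩
        s + 1/ 3        ∎

    -- The weight `w` has total `s + 1/ 3`, so the value `1/ 3` would force `s` to be zero. Then
    -- `1/ 3`, which is `s * r`, would vanish, and so would its triple `1#`.
    unfrozen⇒NCF≢1/3 : ¬ IsNCF K (NAEModel K H) (1/ 3)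
    unfrozen⇒NCF≢1/3 (_ , ∑≤1/3) =
      let b , feasible , ∑b≈∑w = weight⇒feasible w-proper w-minority≤1/3
          s≤0 = +-cancelʳ-≤ (1/ 3) (begin
            s + 1/ 3   ≈⟨ ∑w≈s+1/3 ⟨
            ∑ w        ≈⟨ ∑b≈∑w ⟨
            ∑ b        ≤⟨ ∑≤1/3 b feasible ⟩
            1/ 3       ≈⟨ +-identityˡ (1/ 3) ⟨
            0# + 1/ 3  ∎)
          1/3≈0 = begin-equality
            1/ 3    ≈⟨ s*r≈1/3 ⟨
            s * r   ≈⟨ *-congʳ (antisym s≤0 0≤s) ⟩
            0# * r  ≈⟨ zeroˡ r ⟩
            0#      ∎
      in 0≉1 (≈-trans (≈-sym (≈-trans (+-identityˡ _) (+-identityˡ 0#)))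
                (≈-trans (≈-sym (+-cong 1/3≈0 (+-cong 1/3≈0 1/3≈0))) 1/3+[1/3+1/3]≈1))

  -- Not all events can be unfrozen, and since `Unfrozen?` decides each of the finitely many events,
  -- the failure yields a specific frozen one.
  NCF≡1/3⇒frozen : Fin #E → IsNCF K (NAEModel K H) (1/ 3) → ∃₂ λ e j → Frozen e j
  NCF≡1/3⇒frozen e₀ isNCF =
    let e , ¬unfrozen = ¬∀⟶∃¬ _ _ (λ e → all? (Unfrozen? e)) λ unfrozen → unfrozen⇒NCF≢1/3 e₀ unfrozen isNCF
        j , ¬unfrozenⱼ = ¬∀⟶∃¬ _ _ (Unfrozen? e) ¬unfrozen
    in e , j , ¬Unfrozen⇒Frozen ¬unfrozenⱼ

corollary4p3 : ∀ {c ℓ₁ ℓ₂} (K : OrderedField c ℓ₁ ℓ₂) (H : OrderedHypergraph) →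
    let open OrderedField K
        open Scalars K
        open OrderedHypergraph H
        open Colouring H
        open Probability K H
    in
    NonZero #E →
    ProperColouring →
      (IsNCF K (NAEModel K H) 1# ⇔ ∃ λ (μ : Distribution) → ∀ e j → Pr μ (λ S → (m e ⟨$⟩ S) ≟ j) ≈ 1/ 3)
    × (IsNCF K (NAEModel K H) (1/ 3) ⇔ ∃₂ λ e j → Frozen e j)
corollary4p3 K H #E≢0 S₀ =
    mk⇔ NCF≡1⇒uniform (uniform⇒NCF≡1 e₀)
  , mk⇔ (NCF≡1/3⇒frozen e₀) (frozen⇒NCF≡1/3 S₀)
  where
  open Fractions K H
  -- A hyperedge, whose three minority masses control the total weight.
  e₀ = fromℕ< (>-nonZero⁻¹ _ {{#E≢0}})
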